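{- Let $n\geq 2$, let $f\in\mathcal{H}^n$ and let $X\subseteq R^n$ be a fan. Then $\sum_{x\in R^n}f(x)\mathbf{1}_X(x)=0$ in $\mathbb{Z}/p\mathbb{Z}$.
   Context: Let $p$ be prime, $k\in\mathbb{N}$, $R=\mathbb{Z}/p^k\mathbb{Z}$, $\langle x,b\rangle=\sum_ix_ib_i\in R$. Directions $\mathbb{P}R^{n-1}$: vectors in $R^n$ with some invertible coordinate, modulo multiplication by $R^\times$. Hyperplanes $H_b(a)=\{x:\langle x-a,b\rangle=0\text{ in }R\}$; $\mathcal{H}^n$ is the $\mathbb{Z}/p\mathbb{Z}$-span of the indicators $\mathbf{1}_{H_b(a)}:R^n\to\mathbb{Z}/p\mathbb{Z}$. Canonical directions: $\mathcal{B}=\bigcup_{i=1}^n\mathcal{B}_i$, $\mathcal{B}_i=\{(p\ell_1,\dots,p\ell_{i-1},1,\ell_{i+1},\dots,\ell_n):\ell_j\in R\}$. A line is a set $\{a+tb:t\in R\}$ with $a\in R^n$ and $b$ a direction; every line has this form for a unique $b\in\mathcal{B}$, called its direction. For $b,b'\in\mathcal{B}$, the $p$-adic angle is $\angle(b,b')=p^{ -s}$ where $s$ is the largest integer with $p^s$ dividing every coordinate of $b-b'$; $\angle(L,L')$ is the angle of their directions (so $\angle=1$ means $b-b'\not\equiv0\bmod p$). For $0\le\ell\le k$, a cube on scale $\ell$ is $Q_\ell(x)=\{y\in R^n:y\equiv x\bmod p^\ell \text{ coordinatewise}\}$. A 2-plane through $a$ is $a+\{\lambda u+\mu v:\lambda,\mu\in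 R\}$ for $u,v\in\mathcal{B}$ with $\angle(u,v)=1$. For $S\subseteq R^n$ and $j\ge0$, $\mathcal{N}_j(S)=\{x\in R^n:\exists s\in S,\ p^j\mid(x-s)\}$. Fan ($n=2$): let $0\le\ell\le k-2$, let $Q$ be a cube on scale $\ell+1$, $Q'$ the cube on scale $\ell$ containing $Q$, and $L_0,\dots,L_p$ lines each intersecting $Q$ with $\angle(L_i,L_j)=1$ for $i\ne j$; then $X=\bigcup_{i=0}^p(L_i\cap Q')\setminus Q$ is a fan. Fan ($n>2$): let $0\le\ell\le k-2$, $Q'$ a cube on scale $\ell$, $\Pi_0$ a 2-plane through a point $a\in Q'$, $\Pi=Q'\cap\mathcal{N}_{\ell+1}(\Pi_0)$, $Q=Q_{\ell+1}(a)$; let $L_0,\dots,L_p$ be lines each intersecting $Q$, with $\angle(L_i,L_j)=1$ for $i\neq j$, and $L_j\cap Q'\subseteq\Pi$ for all $j$; then $X=\bigcup_{i=0}^p(L_i\cap Q')\setminus Q$ is a fan. -}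

module Defs where

open import Data.Nat using (ℕ; zero; suc; _+_; _*_; _∸_; _^_; _≤_; _<_)
open import Data.Nat.Properties using (_<?_)
open import Data.Nat.Divisibility using (_∣_; _∣?_)
open import Data.Fin using (Fin; toℕ)
open import Data.Fin.Properties using (any?; all?)
open import Data.List using (List; []; _∷_; map; concatMap; allFin)
open import Data.Nat.ListAction using (sum)
open import Data.Product using (Σ; ∃; ∃-syntax; _×_; _,_)
open import Data.Unit using (⊤)
open import Relation.Nullary using (Dec; yes; no; ¬_)
open import Relation.Binary.PropositionalEquality using (_≡_)
open import Relation.Nullary.Decidable using (_×-dec_; ¬?)

-- Congruence of natural numbers modulo m:  a ≡ b (mod m)
-- (m ∣ a ∸ b and m ∣ b ∸ a; one of the two differences is 0).

ModEq : ℕ → ℕ → ℕ → Set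
ModEq m a b = (m ∣ (a ∸ b)) × (m ∣ (b ∸ a))

modEq? : (m a b : ℕ) → Dec (ModEq m a b)
modEq? m a b = (m ∣? (a ∸ b)) ×-dec (m ∣? (b ∸ a))

ind : ∀ {ℓ} {P : Set ℓ} → Dec P → ℕ
ind (yes _) = 1
ind (no _)  = 0

-- R = ℤ/p^k ℤ is represented by Fin (p ^ k) (canonical residues);
-- a point of R^n is a function Fin n → Fin (p ^ k).

Pt : ℕ → ℕ → ℕ → Set
Pt p k n = Fin n → Fin (p ^ k)

consF : ∀ {n q} → Fin q → (Fin n → Fin q) → (Fin (suc n) → Fin q)
consF r v Fin.zero    = r
consF r v (Fin.suc i) = v i

allPoints : (n q : ℕ) → List (Fin n → Fin q)
allPoints zero    q = (λ ()) ∷ []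
allPoints (suc n) q =
  concatMap (λ r → map (consF r) (allPoints n q)) (allFin q)

-- ⟨x , b⟩ computed on representatives (to be read modulo p^k).
dot : ∀ {n q} → (Fin n → Fin q) → (Fin n → Fin q) → ℕ
dot {n} x b = sum (map (λ i → toℕ (x i) * toℕ (b i)) (allFin n))

module _ (p k : ℕ) where

  q : ℕ
  q = p ^ k

  IsUnit : Fin q → Set
  IsUnit r = Σ (Fin q) λ s → ModEq q (toℕ r * toℕ s) 1

  IsDirection : ∀ {n} → Pt p k n → Set
  IsDirection {n} b = ∃[ i ] IsUnit (b i)

  InHyp : ∀ {n} → (a b x : Pt p k n) → Set
  InHyp a b x = ModEq q (dot x b) (dot a b)

  inHyp? : ∀ {n} → (a b x : Pt p k n) → Dec (InHyp a b x)
  inHyp? a b x = modEq? q (dot x b) (dot a b)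

  Term : ℕ → Set
  Term n = ℕ × Pt p k n × Pt p k n

  combo : ∀ {n} → List (Term n) → Pt p k n → ℕ
  combo []                  x = 0
  combo ((c , a , b) ∷ ts) x = c * ind (inHyp? a b x) + combo ts x

  AllDirections : ∀ {n} → List (Term n) → Set
  AllDirections []                  = ⊤
  AllDirections ((c , a , b) ∷ ts) = IsDirection b × AllDirections ts

  -- f : R^n → ℤ/pℤ (values represented by naturals, read modulo p)
  -- lies in 𝓗ⁿ, the ℤ/pℤ-span of hyperplane indicators.
  InH : ∀ {n} → (Pt p k n → ℕ) → Set
  InH {n} f = Σ (List (Term n)) λ ts →
                AllDirections ts × (∀ x → ModEq p (f x) (combo ts x))

  InB : ∀ {n} → Pt p k n → Set
  InB {n} b = ∃[ i ] (ModEq q (toℕ (b i)) 1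
                      × (∀ (j : Fin n) → toℕ j < toℕ i → p ∣ toℕ (b j)))

  AngleOne : ∀ {n} → Pt p k n → Pt p k n → Set
  AngleOne b b' = ¬ (∀ i → ModEq p (toℕ (b i)) (toℕ (b' i)))

  OnLine : ∀ {n} → (a b x : Pt p k n) → Set
  OnLine a b x = Σ (Fin q) λ t → (∀ i → ModEq q (toℕ (x i)) (toℕ (a i) + toℕ t * toℕ (b i)))

  onLine? : ∀ {n} → (a b x : Pt p k n) → Dec (OnLine a b x)
  onLine? a b x = any? λ t → all? λ i →
    modEq? q (toℕ (x i)) (toℕ (a i) + toℕ t * toℕ (b i))

  InCube : ∀ {n} → ℕ → (c y : Pt p k n) → Set
  InCube ℓ c y = ∀ i → ModEq (p ^ ℓ) (toℕ (y i)) (toℕ (c i))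

  inCube? : ∀ {n} → (ℓ : ℕ) → (c y : Pt p k n) → Dec (InCube ℓ c y)
  inCube? ℓ c y = all? λ i → modEq? (p ^ ℓ) (toℕ (y i)) (toℕ (c i))

  InNbhdPlane : ∀ {n} → ℕ → (a u v x : Pt p k n) → Set
  InNbhdPlane j a u v x = Σ (Fin q) λ λ' → Σ (Fin q) λ μ → (∀ i →
    ModEq (p ^ j) (toℕ (x i)) (toℕ (a i) + toℕ λ' * toℕ (u i) + toℕ μ * toℕ (v i)))

  -- Extra condition for a fan in dimension n > 2 (none for n = 2):
  -- there is a 2-plane Π₀ through a with L_j ∩ Q' ⊆ Π = Q' ∩ 𝓝_{ℓ+1}(Π₀).
  PlaneCond : (n : ℕ) → ℕ → (c' a : Pt p k n) →
              (Fin (suc p) → Pt p k n) → (Fin (suc p) → Pt p k n) → Set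
  PlaneCond zero                ℓ c' a la lb = ⊤
  PlaneCond (suc zero)          ℓ c' a la lb = ⊤
  PlaneCond (suc (suc zero))    ℓ c' a la lb = ⊤
  PlaneCond (suc (suc (suc _))) ℓ c' a la lb =
    ∃[ u ] ∃[ v ] (InB u × InB v × AngleOne u v ×
      (∀ j x → OnLine (la j) (lb j) x → InCube ℓ c' x →
         InCube ℓ c' x × InNbhdPlane (suc ℓ) a u v x))

  -- Data of a fan in R^n:  Q' = Q_ℓ(c'), a ∈ Q', Q = Q_{ℓ+1}(a),
  -- lines L_i = {la i + t · lb i}, i = 0..p, with lb i ∈ 𝓑.
  -- (For n = 2, Q is an arbitrary cube on scale ℓ+1 and Q' the cube on
  -- scale ℓ containing it, which is exactly this parametrisation.)
  record Fan (n : ℕ) : Set where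
    field
      ℓ      : ℕ
      ℓ≤k-2  : ℓ + 2 ≤ k
      c'     : Pt p k n
      a      : Pt p k n
      a∈Q'   : InCube ℓ c' a
      la     : Fin (suc p) → Pt p k n
      lb     : Fin (suc p) → Pt p k n
      lb∈B   : ∀ i → InB (lb i)
      meetsQ : ∀ i → ∃[ x ] (OnLine (la i) (lb i) x × InCube (suc ℓ) a x)
      angles : ∀ i j → ¬ (i ≡ j) → AngleOne (lb i) (lb j)
      plane  : PlaneCond n ℓ c' a la lb

  InFan : ∀ {n} → Fan n → Pt p k n → Set
  InFan F x = (∃[ i ] (OnLine (la i) (lb i) x × InCube ℓ c' x))
              × ¬ InCube (suc ℓ) a x
    where open Fan F

  inFan? : ∀ {n} → (F : Fan n) → (x : Pt p k n) → Dec (InFan F x)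
  inFan? F x =
    (any? (λ i → onLine? (la i) (lb i) x ×-dec inCube? ℓ c' x))
    ×-dec ¬? (inCube? (suc ℓ) a x)
    where open Fan F

{-# OPTIONS --safe #-}
module Submission where

-- By linearity it is enough to count X ∩ H modulo p for one hyperplane H = H_b(α).
-- Choose x_i ∈ L_i ∩ Q.  The points of (L_i ∩ Q') ∖ Q are x_i + t b_i with p^ℓ
-- exactly dividing t, and the sets (L_i ∩ Q') ∖ Q are disjoint because the b_i are
-- pairwise independent modulo p.  Such a point is on H iff p^k ∣ D_i + t e_i, where
-- D_i = ⟨x_i - α , b⟩ and e_i = ⟨b_i , b⟩; modulo p^(ℓ+1) all the D_i agree with
-- D = ⟨a - α , b⟩.
--   * If p^ℓ ∤ D there are no solutions.
--   * If p^(ℓ+1) ∣ D, solutions exist only when p ∣ e_i, and then t ↦ t + p^(k-1)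
--     permutes them (here ℓ + 2 ≤ k is used), so their number is divisible by p.
--   * If p^ℓ exactly divides D, line i contributes one solution if p ∤ e_i and none
--     otherwise.  The b_i modulo p are p + 1 directions of one plane, hence all of
--     them, and a linear form on the plane is nonzero on 0 or p of them.

open import Defs
import Data.Nat as ℕ
import Data.Nat.Properties as ℕₚ
import Data.Nat.Divisibility as ℕ∣
import Data.Nat.Tactic.RingSolver as ℕSolver
import Data.Nat.Coprimality as Coprimality
open import Data.Nat.GCD using (module Bézout)
open import Data.Nat.Primality using (Prime; prime⇒nonZero; prime⇒irreducible; euclidsLemma; ¬prime[1])
open import Data.Nat.ListAction using (sum)
open import Data.Nat.ListAction.Properties using (sum-++)
open import Data.Fin using (Fin; zero; suc; toℕ; fromℕ<)
import Data.Fin.Properties as Finₚ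
open import Data.List using (List; []; _∷_; map; concatMap; allFin; _++_)
open import Data.List.Properties using (map-++; map-∘; map-tabulate)
open import Data.Product using (Σ; ∃; ∃₂; _×_; _,_; proj₁; proj₂)
open import Data.Sum using (_⊎_; inj₁; inj₂)
open import Function using (_∘_; id)
open import Relation.Binary.Definitions using (Tri; tri<; tri≈; tri>)
open import Relation.Nullary using (Dec; yes; no; ¬_; contradiction)
open import Relation.Nullary.Decidable using (_×-dec_; ¬?; map′)
open import Relation.Binary.PropositionalEquality using (_≡_; _≢_; _≗_; refl; sym; trans; cong; cong₂; subst; subst₂;
  module ≡-Reasoning)

-- Indicators of decidable propositions.

ind-yes : {A : Set} → A → (A? : Dec A) → ind A? ≡ 1
ind-yes a (yes _) = refl
ind-yes a (no ¬a) = contradiction a ¬a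

ind-no : {A : Set} → ¬ A → (A? : Dec A) → ind A? ≡ 0
ind-no ¬a (yes a) = contradiction a ¬a
ind-no ¬a (no _)  = refl

ind-cong : {A B : Set} → (A → B) → (B → A) →
           (A? : Dec A) (B? : Dec B) → ind A? ≡ ind B?
ind-cong f g (yes a) B? = sym (ind-yes (f a) B?)
ind-cong f g (no ¬a) B? = sym (ind-no (¬a ∘ g) B?)

ind-× : {A B : Set} (A? : Dec A) (B? : Dec B) →
        ind A? ℕ.* ind B? ≡ ind (A? ×-dec B?)
ind-× (yes _) (yes _) = refl
ind-× (yes _) (no _)  = refl
ind-× (no _)  _       = refl

-- Finite sums of naturals

private
  variable
    A B : Set

∑ : List A → (A → ℕ.ℕ) → ℕ.ℕ
∑ xs f = sum (map f xs)

∑-cong : (xs : List A) {f g : A → ℕ.ℕ} → f ≗ g → ∑ xs f ≡ ∑ xs g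
∑-cong []       f≗g = refl
∑-cong (x ∷ xs) f≗g = cong₂ ℕ._+_ (f≗g x) (∑-cong xs f≗g)

∑-zero : (xs : List A) {f : A → ℕ.ℕ} → (∀ x → f x ≡ 0) → ∑ xs f ≡ 0
∑-zero []       f≡0 = refl
∑-zero (x ∷ xs) f≡0 = cong₂ ℕ._+_ (f≡0 x) (∑-zero xs f≡0)

∑-distrib-+ : (xs : List A) (f g : A → ℕ.ℕ) →
              ∑ xs (λ x → f x ℕ.+ g x) ≡ ∑ xs f ℕ.+ ∑ xs g
∑-distrib-+ []       f g = refl
∑-distrib-+ (x ∷ xs) f g = trans
  (cong ((f x ℕ.+ g x) ℕ.+_) (∑-distrib-+ xs f g))
  (ℕ-interchange (f x) (g x) (∑ xs f) (∑ xs g))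
  where
  ℕ-interchange : ∀ a b c d → (a ℕ.+ b) ℕ.+ (c ℕ.+ d) ≡ (a ℕ.+ c) ℕ.+ (b ℕ.+ d)
  ℕ-interchange = ℕSolver.solve-∀

∑-*ˡ : (xs : List A) (c : ℕ.ℕ) (f : A → ℕ.ℕ) →
       ∑ xs (λ x → c ℕ.* f x) ≡ c ℕ.* ∑ xs f
∑-*ˡ []       c f = sym (ℕₚ.*-zeroʳ c)
∑-*ˡ (x ∷ xs) c f = trans (cong (c ℕ.* f x ℕ.+_) (∑-*ˡ xs c f))
                          (sym (ℕₚ.*-distribˡ-+ c (f x) (∑ xs f)))

∑-∣ : (xs : List A) {d : ℕ.ℕ} {f : A → ℕ.ℕ} → (∀ x → d ℕ∣.∣ f x) → d ℕ∣.∣ ∑ xs f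
∑-∣ []       d∣f = _ ℕ∣.∣0
∑-∣ (x ∷ xs) d∣f = ℕ∣.∣m∣n⇒∣m+n (d∣f x) (∑-∣ xs d∣f)

∑-swap : (xs : List A) (ys : List B) (f : A → B → ℕ.ℕ) →
         ∑ xs (λ x → ∑ ys (f x)) ≡ ∑ ys (λ y → ∑ xs (λ x → f x y))
∑-swap []       ys f = sym (∑-zero ys λ _ → refl)
∑-swap (x ∷ xs) ys f = trans
  (cong (∑ ys (f x) ℕ.+_) (∑-swap xs ys f))
  (sym (∑-distrib-+ ys (f x) (λ y → ∑ xs (λ x → f x y))))

∑-concatMap : (g : A → List B) (xs : List A) (f : B → ℕ.ℕ) →
              ∑ (concatMap g xs) f ≡ ∑ xs (λ x → ∑ (g x) f)
∑-concatMap g []       f = refl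
∑-concatMap g (x ∷ xs) f = begin
  sum (map f (g x ++ concatMap g xs))      ≡⟨ cong sum (map-++ f (g x) _) ⟩
  sum (map f (g x) ++ map f (concatMap g xs)) ≡⟨ sum-++ (map f (g x)) _ ⟩
  ∑ (g x) f ℕ.+ ∑ (concatMap g xs) f       ≡⟨ cong (∑ (g x) f ℕ.+_) (∑-concatMap g xs f) ⟩
  ∑ (g x) f ℕ.+ ∑ xs (λ x → ∑ (g x) f)     ∎
  where open ≡-Reasoning

∑-allFin-suc : ∀ {n} (f : Fin (ℕ.suc n) → ℕ.ℕ) →
               ∑ (allFin (ℕ.suc n)) f ≡ f zero ℕ.+ ∑ (allFin n) (f ∘ suc)
∑-allFin-suc {n} f = cong (λ xs → f zero ℕ.+ sum xs)
  (trans (map-tabulate suc f) (sym (map-tabulate id (f ∘ suc))))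

∑-allFin-const : ∀ n c → ∑ (allFin n) (λ _ → c) ≡ n ℕ.* c
∑-allFin-const ℕ.zero    c = refl
∑-allFin-const (ℕ.suc n) c =
  trans (∑-allFin-suc {n} (λ _ → c)) (cong (c ℕ.+_) (∑-allFin-const n c))

∑-allFin-single : ∀ {n} (f : Fin n → ℕ.ℕ) (i : Fin n) →
                  (∀ j → j ≢ i → f j ≡ 0) → ∑ (allFin n) f ≡ f i
∑-allFin-single {ℕ.suc n} f zero f≡0 = begin
  ∑ (allFin (ℕ.suc n)) f                ≡⟨ ∑-allFin-suc f ⟩
  f zero ℕ.+ ∑ (allFin n) (f ∘ suc)     ≡⟨ cong (f zero ℕ.+_) (∑-zero (allFin n) λ j → f≡0 (suc j) λ ()) ⟩
  f zero ℕ.+ 0                          ≡⟨ ℕₚ.+-identityʳ _ ⟩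
  f zero                                ∎
  where open ≡-Reasoning
∑-allFin-single {ℕ.suc n} f (suc i) f≡0 = begin
  ∑ (allFin (ℕ.suc n)) f                ≡⟨ ∑-allFin-suc f ⟩
  f zero ℕ.+ ∑ (allFin n) (f ∘ suc)     ≡⟨ cong (ℕ._+ ∑ (allFin n) (f ∘ suc)) (f≡0 zero λ ()) ⟩
  ∑ (allFin n) (f ∘ suc)                ≡⟨ ∑-allFin-single (f ∘ suc) i (λ j j≢i → f≡0 (suc j) (j≢i ∘ Finₚ.suc-injective)) ⟩
  f (suc i)                             ∎
  where open ≡-Reasoning

∑-allFin-+ : ∀ m n (h : ℕ.ℕ → ℕ.ℕ) →
             ∑ (allFin (m ℕ.+ n)) (h ∘ toℕ)
             ≡ ∑ (allFin m) (h ∘ toℕ) ℕ.+ ∑ (allFin n) (λ i → h (m ℕ.+ toℕ i))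
∑-allFin-+ ℕ.zero    n h = refl
∑-allFin-+ (ℕ.suc m) n h = begin
  ∑ (allFin (ℕ.suc (m ℕ.+ n))) (h ∘ toℕ)
    ≡⟨ ∑-allFin-suc {m ℕ.+ n} (h ∘ toℕ) ⟩
  h 0 ℕ.+ ∑ (allFin (m ℕ.+ n)) (h ∘ ℕ.suc ∘ toℕ)
    ≡⟨ cong (h 0 ℕ.+_) (∑-allFin-+ m n (h ∘ ℕ.suc)) ⟩
  h 0 ℕ.+ (∑ (allFin m) (h ∘ ℕ.suc ∘ toℕ) ℕ.+ rest)
    ≡⟨ ℕₚ.+-assoc (h 0) _ rest ⟨
  h 0 ℕ.+ ∑ (allFin m) (h ∘ ℕ.suc ∘ toℕ) ℕ.+ rest
    ≡⟨ cong (ℕ._+ rest) (∑-allFin-suc {m} (h ∘ toℕ)) ⟨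
  ∑ (allFin (ℕ.suc m)) (h ∘ toℕ) ℕ.+ rest ∎
  where
  open ≡-Reasoning
  rest = ∑ (allFin n) (λ i → h (ℕ.suc m ℕ.+ toℕ i))

-- The range splits into `m` blocks of length `r`, and each block has the same sum. The function `h`
-- lives on ℕ, so that shifting an index never leaves its domain. With `m` = p this makes a count
-- divisible by p.
∑-allFin-periodic : ∀ m r (h : ℕ.ℕ → ℕ.ℕ) → (∀ t → h (r ℕ.+ t) ≡ h t) →
                    ∑ (allFin (m ℕ.* r)) (h ∘ toℕ) ≡ m ℕ.* ∑ (allFin r) (h ∘ toℕ)
∑-allFin-periodic ℕ.zero    r h per = refl
∑-allFin-periodic (ℕ.suc m) r h per = begin
  ∑ (allFin (r ℕ.+ m ℕ.* r)) (h ∘ toℕ)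
    ≡⟨ ∑-allFin-+ r (m ℕ.* r) h ⟩
  ∑ (allFin r) (h ∘ toℕ) ℕ.+ ∑ (allFin (m ℕ.* r)) (λ i → h (r ℕ.+ toℕ i))
    ≡⟨ cong (∑ (allFin r) (h ∘ toℕ) ℕ.+_) (∑-cong (allFin (m ℕ.* r)) (per ∘ toℕ)) ⟩
  ∑ (allFin r) (h ∘ toℕ) ℕ.+ ∑ (allFin (m ℕ.* r)) (h ∘ toℕ)
    ≡⟨ cong (∑ (allFin r) (h ∘ toℕ) ℕ.+_) (∑-allFin-periodic m r h per) ⟩
  ∑ (allFin r) (h ∘ toℕ) ℕ.+ m ℕ.* ∑ (allFin r) (h ∘ toℕ) ∎
  where open ≡-Reasoning

-- Points are functions and pointwise equality does not yield propositional equality, so `f` is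
-- asked to respect `≗`.
∑-allPoints-single : ∀ n {Q} (f : (Fin n → Fin Q) → ℕ.ℕ) (x : Fin n → Fin Q) →
                     (∀ {y z} → y ≗ z → f y ≡ f z) →
                     (∀ y → ¬ y ≗ x → f y ≡ 0) → ∑ (allPoints n Q) f ≡ f x
∑-allPoints-single ℕ.zero    f x resp f≡0 = trans (ℕₚ.+-identityʳ _) (resp λ ())
∑-allPoints-single (ℕ.suc n) {Q} f x resp f≡0 = begin
  ∑ (allPoints (ℕ.suc n) Q) f
    ≡⟨ ∑-concatMap (λ r → map (consF r) (allPoints n Q)) (allFin Q) f ⟩
  ∑ (allFin Q) (λ r → ∑ (map (consF r) (allPoints n Q)) f)
    ≡⟨ ∑-cong (allFin Q) (λ r → cong sum (sym (map-∘ (allPoints n Q)))) ⟩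
  ∑ (allFin Q) (λ r → ∑ (allPoints n Q) (f ∘ consF r))
    ≡⟨ ∑-allFin-single _ (x zero) (λ r r≢ → ∑-zero (allPoints n Q) λ v →
         f≡0 (consF r v) λ eq → r≢ (eq zero)) ⟩
  ∑ (allPoints n Q) (f ∘ consF (x zero))
    ≡⟨ ∑-allPoints-single n (f ∘ consF (x zero)) (x ∘ suc)
         (λ y≗z → resp (λ { zero → refl ; (suc i) → y≗z i }))
         (λ y y≢ → f≡0 _ λ eq → y≢ (eq ∘ suc)) ⟩
  f (consF (x zero) (x ∘ suc))
    ≡⟨ resp (λ { zero → refl ; (suc i) → refl }) ⟩
  f x ∎
  where open ≡-Reasoning

-- Counting a set of points through a parametrisation.

_≗?_ : ∀ {n Q} (x y : Fin n → Fin Q) → Dec (x ≗ y)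
x ≗? y = Finₚ.all? λ i → x i Finₚ.≟ y i

-- The indicator of `Y` at x is the number of admissible pairs (i, t) that hit x: one by `param` and
-- `inj`, or none by `sound`. Exchanging the sums then leaves one point per admissible pair.
-- Injectivity is asked only where `K` holds, since lines of a fan may cross inside Q.
count-parametrised :
  ∀ {n Q a b} {Y : (Fin n → Fin Q) → Set} {K : Fin a → Fin b → Set}
  (Y? : ∀ x → Dec (Y x)) (K? : ∀ i t → Dec (K i t))
  (pt : Fin a → Fin b → Fin n → Fin Q) →
  (∀ {x} → Y x → ∃₂ λ i t → x ≗ pt i t × K i t) →
  (∀ {x i t} → x ≗ pt i t → K i t → Y x) →
  (∀ {i j t s} → K i t → K j s → pt i t ≗ pt j s → i ≡ j × t ≡ s) →
  ∑ (allPoints n Q) (λ x → ind (Y? x))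
  ≡ ∑ (allFin a) (λ i → ∑ (allFin b) (λ t → ind (K? i t)))
count-parametrised {n} {Q} {a} {b} {Y} {K} Y? K? pt param sound inj = begin
  ∑ (allPoints n Q) (λ x → ind (Y? x))
    ≡⟨ ∑-cong (allPoints n Q) (λ x → ind≡∑ x (Y? x)) ⟩
  ∑ (allPoints n Q) (λ x → ∑ (allFin a) (λ i → ∑ (allFin b) (λ t → ind (hit? x i t))))
    ≡⟨ ∑-swap (allPoints n Q) (allFin a) _ ⟩
  ∑ (allFin a) (λ i → ∑ (allPoints n Q) (λ x → ∑ (allFin b) (λ t → ind (hit? x i t))))
    ≡⟨ ∑-cong (allFin a) (λ i → ∑-swap (allPoints n Q) (allFin b) _) ⟩
  ∑ (allFin a) (λ i → ∑ (allFin b) (λ t → ∑ (allPoints n Q) (λ x → ind (hit? x i t))))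
    ≡⟨ ∑-cong (allFin a) (λ i → ∑-cong (allFin b) (λ t → ∑-hit i t)) ⟩
  ∑ (allFin a) (λ i → ∑ (allFin b) (λ t → ind (K? i t))) ∎
  where
  open ≡-Reasoning

  hit? : ∀ x i t → Dec (x ≗ pt i t × K i t)
  hit? x i t = (x ≗? pt i t) ×-dec K? i t

  ∑-hit : ∀ i t → ∑ (allPoints n Q) (λ x → ind (hit? x i t)) ≡ ind (K? i t)
  ∑-hit i t = trans
    (∑-allPoints-single n _ (pt i t)
      (λ {y} {z} y≗z → ind-cong
        (λ (eq , κ) → (λ c → trans (sym (y≗z c)) (eq c)) , κ)
        (λ (eq , κ) → (λ c → trans (y≗z c) (eq c)) , κ)
        (hit? y i t) (hit? z i t))
      (λ y y≢ → ind-no (y≢ ∘ proj₁) (hit? y i t)))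
    (ind-cong proj₂ (λ κ → (λ _ → refl) , κ) (hit? (pt i t) i t) (K? i t))

  ind≡∑ : ∀ x (Yx? : Dec (Y x)) →
          ind Yx? ≡ ∑ (allFin a) (λ i → ∑ (allFin b) (λ t → ind (hit? x i t)))
  ind≡∑ x (no ¬Yx) = sym (∑-zero (allFin a) λ i → ∑-zero (allFin b) λ t →
    ind-no (λ (eq , κ) → ¬Yx (sound eq κ)) (hit? x i t))
  ind≡∑ x (yes Yx) with i , t , eq , κ ← param Yx = sym (begin
    ∑ (allFin a) (λ j → ∑ (allFin b) (λ s → ind (hit? x j s)))
      ≡⟨ ∑-allFin-single _ i (λ j j≢i → ∑-zero (allFin b) λ s →
           ind-no (λ h → j≢i (proj₁ (same h))) (hit? x j s)) ⟩
    ∑ (allFin b) (λ s → ind (hit? x i s))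
      ≡⟨ ∑-allFin-single _ t (λ s s≢t → ind-no (λ h → s≢t (proj₂ (same h))) (hit? x i s)) ⟩
    ind (hit? x i t)
      ≡⟨ ind-yes (eq , κ) (hit? x i t) ⟩
    1 ∎)
    where
    same : ∀ {j s} → x ≗ pt j s × K j s → j ≡ i × s ≡ t
    same (eq′ , κ′) = inj κ′ κ (λ c → trans (sym (eq′ c)) (eq c))

-- Congruences between integers

module _ where

  open import Data.Integer using (ℤ; +_; _+_; _*_; _-_; -_; 1ℤ; 0ℤ)
  import Data.Integer as ℤ
  import Data.Integer.Properties as ℤₚ
  open import Data.Integer.DivMod using (n%ℕd<d; a≡a%ℕn+[a/ℕn]*n)
  open import Data.Integer.Divisibility.Signed
  open import Data.Integer.Tactic.RingSolver using (solve-∀)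

  module _ {d x : ℤ} where

    -- Most divisibilities below are proved by certificate: the target is an explicit integer
    -- combination of known multiples of `d`, and the ring solver checks the identity.
    ∣-lin₁ : ∀ {z} → d ∣ x → ∀ a → z ≡ a * x → d ∣ z
    ∣-lin₁ d∣x a eq = subst (d ∣_) (sym eq) (∣n⇒∣m*n a d∣x)

    ∣-lin₂ : ∀ {y z} → d ∣ x → d ∣ y → ∀ a b → z ≡ a * x + b * y → d ∣ z
    ∣-lin₂ d∣x d∣y a b eq =
      subst (d ∣_) (sym eq) (∣m∣n⇒∣m+n (∣n⇒∣m*n a d∣x) (∣n⇒∣m*n b d∣y))

    ∣-lin₃ : ∀ {y w z} → d ∣ x → d ∣ y → d ∣ w → ∀ a b c →
             z ≡ a * x + b * y + c * w → d ∣ z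
    ∣-lin₃ d∣x d∣y d∣w a b c eq =
      subst (d ∣_) (sym eq) (∣m∣n⇒∣m+n (∣m∣n⇒∣m+n (∣n⇒∣m*n a d∣x) (∣n⇒∣m*n b d∣y)) (∣n⇒∣m*n c d∣w))

    ∣-lin₄ : ∀ {y w v z} → d ∣ x → d ∣ y → d ∣ w → d ∣ v → ∀ a b c e →
             z ≡ a * x + b * y + c * w + e * v → d ∣ z
    ∣-lin₄ d∣x d∣y d∣w d∣v a b c e eq =
      subst (d ∣_) (sym eq) (∣m∣n⇒∣m+n (∣-lin₃ d∣x d∣y d∣w a b c refl) (∣n⇒∣m*n e d∣v))

  private
    -- One truncated difference vanishes and the other is the absolute value of the integer
    -- difference. This lets `ModEq` be exchanged for signed divisibility, where ring identities
    -- apply.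
    ∣+a-+b∣ : ∀ a b → (ℤ.∣ + a - + b ∣ ≡ a ℕ.∸ b × b ℕ.∸ a ≡ 0)
                    ⊎ (ℤ.∣ + a - + b ∣ ≡ b ℕ.∸ a × a ℕ.∸ b ≡ 0)
    ∣+a-+b∣ a b with ℕₚ.≤-total a b
    ... | inj₁ a≤b = inj₂ (trans (cong ℤ.∣_∣ (ℤₚ.m-n≡m⊖n a b)) (ℤₚ.∣⊖∣-≤ a≤b) , ℕₚ.m≤n⇒m∸n≡0 a≤b)
    ... | inj₂ b≤a = inj₁ (trans (cong ℤ.∣_∣ (ℤₚ.m-n≡m⊖n a b)) (cong ℤ.∣_∣ (ℤₚ.⊖-≥ b≤a)) , ℕₚ.m≤n⇒m∸n≡0 b≤a)

  ModEq⇒∣ : ∀ {m} a b → ModEq m a b → + m ∣ + a - + b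
  ModEq⇒∣ {m} a b (l , r) with ∣+a-+b∣ a b
  ... | inj₁ (eq , _) = ∣ᵤ⇒∣ (subst (m ℕ∣.∣_) (sym eq) l)
  ... | inj₂ (eq , _) = ∣ᵤ⇒∣ (subst (m ℕ∣.∣_) (sym eq) r)

  ∣⇒ModEq : ∀ {m} a b → + m ∣ + a - + b → ModEq m a b
  ∣⇒ModEq {m} a b d with ∣+a-+b∣ a b
  ... | inj₁ (eq , z) = subst (m ℕ∣.∣_) eq (∣⇒∣ᵤ d) , subst (m ℕ∣.∣_) (sym z) (m ℕ∣.∣0)
  ... | inj₂ (eq , z) = subst (m ℕ∣.∣_) (sym z) (m ℕ∣.∣0) , subst (m ℕ∣.∣_) eq (∣⇒∣ᵤ d)

  residue : ∀ m .{{_ : ℕ.NonZero m}} (z : ℤ) → Σ (Fin m) λ r → + m ∣ + toℕ r - z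
  residue m z = r , divides (- (z ℤ./ℕ m)) (begin
    + toℕ r - z                                   ≡⟨ cong (λ r → + r - z) (Finₚ.toℕ-fromℕ< r<m) ⟩
    + (z ℤ.%ℕ m) - z                              ≡⟨ cong (λ z′ → + (z ℤ.%ℕ m) - z′) (a≡a%ℕn+[a/ℕn]*n z m) ⟩
    + (z ℤ.%ℕ m) - (+ (z ℤ.%ℕ m) + z ℤ./ℕ m * + m) ≡⟨ identity (+ (z ℤ.%ℕ m)) (z ℤ./ℕ m) (+ m) ⟩
    - (z ℤ./ℕ m) * + m                            ∎)
    where
    open ≡-Reasoning
    r<m = n%ℕd<d z m
    r   = fromℕ< r<m
    identity : ∀ a b c → a - (a + b * c) ≡ - b * c
    identity = solve-∀

  -- Each truncated difference is a multiple of `m` smaller than `m`, hence zero.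
  residue-unique : ∀ {m} (r s : Fin m) → + m ∣ + toℕ r - + toℕ s → r ≡ s
  residue-unique {m} r s d = Finₚ.toℕ-injective (ℕₚ.≤-antisym
    (∸≡0⇒≤ (proj₁ r≡s) (Finₚ.toℕ<n r)) (∸≡0⇒≤ (proj₂ r≡s) (Finₚ.toℕ<n s)))
    where
    r≡s = ∣⇒ModEq (toℕ r) (toℕ s) d
    ∸≡0⇒≤ : ∀ {a b} → m ℕ∣.∣ a ℕ.∸ b → a ℕ.< m → a ℕ.≤ b
    ∸≡0⇒≤ {a} {b} m∣a∸b a<m with a ℕ.∸ b in eq
    ... | ℕ.zero  = ℕₚ.m∸n≡0⇒m≤n eq
    ... | ℕ.suc _ = contradiction a<m (ℕₚ.≤⇒≯ (ℕₚ.≤-trans (ℕ∣.∣⇒≤ m∣a∸b)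
                      (ℕₚ.≤-trans (ℕₚ.≤-reflexive (sym eq)) (ℕₚ.m∸n≤m a b))))

  -- Divisibility by powers of a prime

  module PrimePowers (p : ℕ.ℕ) (pr : Prime p) where

    instance
      p≢0 : ℕ.NonZero p
      p≢0 = prime⇒nonZero pr

    p^m≢0 : ∀ m → ℕ.NonZero (p ℕ.^ m)
    p^m≢0 m = ℕₚ.m^n≢0 p m

    P : ℕ.ℕ → ℤ
    P m = + (p ℕ.^ m)

    P-suc : ∀ m → P (ℕ.suc m) ≡ + p * P m
    P-suc m = ℤₚ.pos-* p (p ℕ.^ m)

    P-mono : ∀ {i j} → i ℕ.≤ j → P i ∣ P j
    P-mono {i} {j} i≤j = ∣ᵤ⇒∣ (subst (λ j → p ℕ.^ i ℕ∣.∣ p ℕ.^ j) (ℕₚ.m+[n∸m]≡n i≤j)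
      (subst (p ℕ.^ i ℕ∣.∣_) (sym (ℕₚ.^-distribˡ-+-* p i (j ℕ.∸ i))) (ℕ∣.m∣m*n (p ℕ.^ (j ℕ.∸ i)))))

    P-suc-∣-* : ∀ {m x y} → + p ∣ x → P m ∣ y → P (ℕ.suc m) ∣ x * y
    P-suc-∣-* {m} (divides a refl) (divides b refl) =
      divides (a * b) (trans (identity a b (+ p) (P m)) (cong (a * b *_) (sym (P-suc m))))
      where
      identity : ∀ a b x y → a * x * (b * y) ≡ a * b * (x * y)
      identity = solve-∀

    p∤1 : ¬ + p ∣ 1ℤ
    p∤1 p∣1 = ¬prime[1] (subst Prime (ℕ∣.∣1⇒≡1 (∣⇒∣ᵤ p∣1)) pr)

    p-cancelˡ : ∀ x {y} → ¬ + p ∣ x → + p ∣ x * y → + p ∣ y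
    p-cancelˡ x {y} p∤x p∣xy
      with euclidsLemma ℤ.∣ x ∣ ℤ.∣ y ∣ pr (subst (p ℕ∣.∣_) (ℤₚ.abs-* x y) (∣⇒∣ᵤ p∣xy))
    ... | inj₁ p∣x = contradiction (∣ᵤ⇒∣ p∣x) p∤x
    ... | inj₂ p∣y = ∣ᵤ⇒∣ p∣y

    -- Induction on `m`: the weaker divisibility gives y = y′ p^m, then p^m cancels from p^(m+1) ∣ x
    -- y′ p^m, and Euclid's lemma applies to p ∣ x y′.
    P-cancelˡ : ∀ m x {y} → ¬ + p ∣ x → P m ∣ x * y → P m ∣ y
    P-cancelˡ ℕ.zero    x {y} p∤x _ = divides y (sym (ℤₚ.*-identityʳ y))
    P-cancelˡ (ℕ.suc m) x p∤x P∣xy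
      with divides y′ refl ← P-cancelˡ m x p∤x (∣-trans (P-mono (ℕₚ.n≤1+n m)) P∣xy) =
      subst (_∣ y′ * P m) (sym (P-suc m)) (*-monoˡ-∣ (P m) (p-cancelˡ x p∤x
        (*-cancelʳ-∣ (P m) {{p^m≢0 m}} (subst (_∣ x * y′ * P m) (P-suc m)
          (subst (P (ℕ.suc m) ∣_) (sym (ℤₚ.*-assoc x y′ (P m))) P∣xy)))))

    inverse-mod-p : ∀ e → ¬ + p ∣ + e → ∃ λ y → + p ∣ + e * y - 1ℤ
    inverse-mod-p e p∤e with Coprimality.coprime-Bézout coprime
      where
      coprime : Coprimality.Coprime p e
      coprime (d∣p , d∣e) with prime⇒irreducible pr d∣p
      ... | inj₁ d≡1  = d≡1
      ... | inj₂ refl = contradiction (∣ᵤ⇒∣ d∣e) p∤e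
    ... | Bézout.+- x y eq = - + y , divides (- + x) (begin
        + e * - + y - 1ℤ       ≡⟨ identity (+ e) (+ y) ⟩
        - (1ℤ + + y * + e)     ≡⟨ cong (λ z → - (1ℤ + z)) (ℤₚ.pos-* y e) ⟨
        - + (1 ℕ.+ y ℕ.* e)    ≡⟨ cong (λ z → - + z) eq ⟩
        - + (x ℕ.* p)          ≡⟨ cong -_ (ℤₚ.pos-* x p) ⟩
        - (+ x * + p)          ≡⟨ ℤₚ.neg-distribˡ-* (+ x) (+ p) ⟩
        - + x * + p            ∎)
      where
      open ≡-Reasoning
      identity : ∀ e y → e * - y - 1ℤ ≡ - (1ℤ + y * e)
      identity = solve-∀
    ... | Bézout.-+ x y eq = + y , divides (+ x) (begin
        + e * + y - 1ℤ           ≡⟨ cong (_- 1ℤ) (ℤₚ.*-comm (+ e) (+ y)) ⟩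
        + y * + e - 1ℤ           ≡⟨ cong (_- 1ℤ) (ℤₚ.pos-* y e) ⟨
        + (y ℕ.* e) - 1ℤ         ≡⟨ cong (λ z → + z - 1ℤ) eq ⟨
        1ℤ + + (x ℕ.* p) - 1ℤ    ≡⟨ cong (λ z → 1ℤ + z - 1ℤ) (ℤₚ.pos-* x p) ⟩
        1ℤ + + x * + p - 1ℤ      ≡⟨ identity (+ x * + p) ⟩
        + x * + p                ∎)
      where
      open ≡-Reasoning
      identity : ∀ z → 1ℤ + z - 1ℤ ≡ z
      identity = solve-∀

    -- Errors multiply: if e x ≡ 1 modulo p and e y ≡ 1 modulo p^m, then 1 - (e x - 1)(e y - 1) is
    -- congruent to 1 modulo p^(m+1). It is a multiple of e, with cofactor x + y - e x y.
    inverse-mod-P : ∀ m e → ¬ + p ∣ + e → ∃ λ y → P m ∣ + e * y - 1ℤ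
    -- Modulo p^0 = 1 any value serves.
    inverse-mod-P ℕ.zero    e p∤e = 0ℤ , divides (+ e * 0ℤ - 1ℤ) (sym (ℤₚ.*-identityʳ _))
    inverse-mod-P (ℕ.suc m) e p∤e
      with x , p∣ex-1 ← inverse-mod-p e p∤e | y , P∣ey-1 ← inverse-mod-P m e p∤e =
      x + y - + e * x * y ,
      ∣-lin₁ (P-suc-∣-* {m} p∣ex-1 P∣ey-1) (- 1ℤ) (identity (+ e) x y)
      where
      identity : ∀ e x y → e * (x + y - e * x * y) - 1ℤ ≡ - 1ℤ * ((e * x - 1ℤ) * (e * y - 1ℤ))
      identity = solve-∀

    -- Counting the points of a line

    module LineCount (k ℓ : ℕ.ℕ) (ℓ+2≤k : ℓ ℕ.+ 2 ℕ.≤ k) where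

      1+ℓ<k : ℕ.suc ℓ ℕ.< k
      1+ℓ<k = subst (ℕ._≤ k) (ℕₚ.+-comm ℓ 2) ℓ+2≤k

      1+ℓ≤k : ℕ.suc ℓ ℕ.≤ k
      1+ℓ≤k = ℕₚ.<⇒≤ 1+ℓ<k

      ℓ≤k : ℓ ℕ.≤ k
      ℓ≤k = ℕₚ.<⇒≤ 1+ℓ≤k

      -- The parameters t of the points of the line x + t b that lie in Q' ∖ Q and
      -- on the hyperplane, when x ∈ Q, D = ⟨x - α , b'⟩ and e = ⟨b , b'⟩.
      record Hit (D : ℤ) (e t : ℕ.ℕ) : Set where
        constructor hit
        field
          inQ'   : P ℓ ∣ + t
          notinQ : ¬ P (ℕ.suc ℓ) ∣ + t
          onH    : P k ∣ D + + t * + e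

      hit? : ∀ D e t → Dec (Hit D e t)
      hit? D e t = map′ (λ (a , b , c) → hit a b c) (λ (hit a b c) → a , b , c)
        ((P ℓ ∣? + t) ×-dec (¬? (P (ℕ.suc ℓ) ∣? + t) ×-dec (P k ∣? D + + t * + e)))

      hits : ℤ → ℕ.ℕ → ℕ.ℕ
      hits D e = ∑ (allFin (p ℕ.^ k)) (λ t → ind (hit? D e (toℕ t)))

      hits-none : ∀ D e → (∀ t → ¬ Hit D e t) → hits D e ≡ 0
      hits-none D e none = ∑-zero (allFin (p ℕ.^ k)) λ t → ind-no (none (toℕ t)) (hit? D e (toℕ t))

      -- Both t e and D + t e are multiples of p^ℓ at a hit, so D would be one as well.
      hits-off : ∀ D e → ¬ P ℓ ∣ D → hits D e ≡ 0
      hits-off D e ℓ∤D = hits-none D e λ t (hit ℓ∣t _ on) →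
        ℓ∤D (∣-lin₂ (∣-trans (P-mono ℓ≤k) on) ℓ∣t 1ℤ (- + e) (identity D (+ t) (+ e)))
        where
        identity : ∀ D t e → D ≡ 1ℤ * (D + t * e) + - e * t
        identity = solve-∀

      -- If p ∤ e, the hyperplane condition modulo p^(ℓ+1) forces p^(ℓ+1) ∣ t, which puts the point
      -- inside Q. If p ∣ e, the set of solutions is periodic.
      hits-deep : ∀ D e → P (ℕ.suc ℓ) ∣ D → p ℕ∣.∣ hits D e
      hits-deep D e 1+ℓ∣D with + p ∣? + e
      ... | no p∤e = subst (p ℕ∣.∣_) (sym (hits-none D e λ t (hit _ 1+ℓ∤t on) →
          1+ℓ∤t (P-cancelˡ (ℕ.suc ℓ) (+ e) p∤e
            (∣-lin₂ (∣-trans (P-mono 1+ℓ≤k) on) 1+ℓ∣D 1ℤ (- 1ℤ) (identity D (+ t) (+ e))))))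
          (p ℕ∣.∣0)
        where
        identity : ∀ D t e → e * t ≡ 1ℤ * (D + t * e) + - 1ℤ * D
        identity = solve-∀
      -- The exponent has to be a successor, so that p^k consists of p periods of length p^(k-1);
      -- passing it with an equation lets it be matched as one.
      ... | yes p∣e = periodic k 1+ℓ<k refl
        where
        -- Translating t by p^(k-1) preserves the conditions because 1 + ℓ ≤ k - 1.
        periodic : ∀ k′ → ℕ.suc ℓ ℕ.< k′ → k′ ≡ k → p ℕ∣.∣ hits D e
        periodic (ℕ.suc k′) (ℕ.s≤s 1+ℓ≤k′) refl = subst (p ℕ∣.∣_)
          (sym (∑-allFin-periodic p (p ℕ.^ k′) (λ t → ind (hit? D e t)) λ t →
            ind-cong (backward t) (forward t) (hit? D e (p ℕ.^ k′ ℕ.+ t)) (hit? D e t)))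
          (ℕ∣.m∣m*n _)
          where
          -- The shift changes D + t e by e p^(k-1), a multiple of p^k because p ∣ e.
          step : P (ℕ.suc k′) ∣ + e * P k′
          step = P-suc-∣-* {k′} p∣e ∣-refl

          1+ℓ∣P : P (ℕ.suc ℓ) ∣ P k′
          1+ℓ∣P = P-mono 1+ℓ≤k′

          ℓ∣P : P ℓ ∣ P k′
          ℓ∣P = ∣-trans (P-mono (ℕₚ.n≤1+n ℓ)) 1+ℓ∣P

          identity₁ : ∀ D r t e → D + t * e ≡ 1ℤ * (D + (r + t) * e) + - 1ℤ * (e * r)
          identity₁ = solve-∀

          identity₂ : ∀ D r t e → D + (r + t) * e ≡ 1ℤ * (D + t * e) + 1ℤ * (e * r)
          identity₂ = solve-∀

          backward : ∀ t → Hit D e (p ℕ.^ k′ ℕ.+ t) → Hit D e t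
          backward t (hit ℓ∣t 1+ℓ∤t on) = hit
            (∣m+n∣m⇒∣n ℓ∣t ℓ∣P)
            (λ 1+ℓ∣t → 1+ℓ∤t (∣m∣n⇒∣m+n 1+ℓ∣P 1+ℓ∣t))
            (∣-lin₂ on step 1ℤ (- 1ℤ) (identity₁ D (P k′) (+ t) (+ e)))

          forward : ∀ t → Hit D e t → Hit D e (p ℕ.^ k′ ℕ.+ t)
          forward t (hit ℓ∣t 1+ℓ∤t on) = hit
            (∣m∣n⇒∣m+n ℓ∣P ℓ∣t)
            (λ 1+ℓ∣t → 1+ℓ∤t (∣m+n∣m⇒∣n 1+ℓ∣t 1+ℓ∣P))
            (∣-lin₂ on step 1ℤ 1ℤ (identity₂ D (P k′) (+ t) (+ e)))

      -- If p ∣ e, then p^(ℓ+1) divides t e, and hence D, against the assumption. Otherwise e is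
      -- invertible modulo p^k, the only candidate is t₀ = -D / e, and t₀ is divisible by exactly
      -- the same power p^ℓ as D.
      hits-shallow : ∀ D e → P ℓ ∣ D → ¬ P (ℕ.suc ℓ) ∣ D →
                     hits D e ≡ ind (¬? (+ p ∣? + e))
      hits-shallow D e ℓ∣D 1+ℓ∤D with + p ∣? + e
      ... | yes p∣e = hits-none D e λ t (hit ℓ∣t _ on) →
          1+ℓ∤D (∣-lin₂ (∣-trans (P-mono 1+ℓ≤k) on) (P-suc-∣-* {ℓ} p∣e ℓ∣t) 1ℤ (- 1ℤ)
            (identity D (+ t) (+ e)))
        where
        identity : ∀ D t e → D ≡ 1ℤ * (D + t * e) + - 1ℤ * (e * t)
        identity = solve-∀
      ... | no p∤e = trans
          (∑-allFin-single (λ t → ind (hit? D e (toℕ t))) t₀ λ t t≢t₀ → ind-no (λ h → t≢t₀ (unique t h)) (hit? D e (toℕ t)))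
          (ind-yes (hit ℓ∣t₀ 1+ℓ∤t₀ on₀) (hit? D e (toℕ t₀)))
        where
        y : ℤ
        y = proj₁ (inverse-mod-P k e p∤e)

        solution = residue (p ℕ.^ k) {{p^m≢0 k}} (- D * y)

        t₀ : Fin (p ℕ.^ k)
        t₀ = proj₁ solution

        on₀ : P k ∣ D + + toℕ t₀ * + e
        on₀ = ∣-lin₂ (proj₂ solution) (proj₂ (inverse-mod-P k e p∤e)) (+ e) (- D)
                (identity D (+ toℕ t₀) (+ e) y)
          where
          identity : ∀ D t e y → D + t * e ≡ e * (t - - D * y) + - D * (e * y - 1ℤ)
          identity = solve-∀

        ℓ∣t₀ : P ℓ ∣ + toℕ t₀
        ℓ∣t₀ = P-cancelˡ ℓ (+ e) p∤e (∣-lin₂ (∣-trans (P-mono ℓ≤k) on₀) ℓ∣D 1ℤ (- 1ℤ)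
                 (identity D (+ toℕ t₀) (+ e)))
          where
          identity : ∀ D t e → e * t ≡ 1ℤ * (D + t * e) + - 1ℤ * D
          identity = solve-∀

        1+ℓ∤t₀ : ¬ P (ℕ.suc ℓ) ∣ + toℕ t₀
        1+ℓ∤t₀ 1+ℓ∣t₀ = 1+ℓ∤D (∣-lin₂ (∣-trans (P-mono 1+ℓ≤k) on₀) 1+ℓ∣t₀ 1ℤ (- + e)
                          (identity D (+ toℕ t₀) (+ e)))
          where
          identity : ∀ D t e → D ≡ 1ℤ * (D + t * e) + - e * t
          identity = solve-∀

        unique : ∀ t → Hit D e (toℕ t) → t ≡ t₀
        unique t (hit _ _ on) = residue-unique t t₀ (P-cancelˡ k (+ e) p∤e
          (∣-lin₂ on on₀ 1ℤ (- 1ℤ) (identity D (+ toℕ t) (+ toℕ t₀) (+ e))))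
          where
          identity : ∀ D t s e → e * (t - s) ≡ 1ℤ * (D + t * e) + - 1ℤ * (D + s * e)
          identity = solve-∀

      -- As the `D i` agree with `D₀` modulo p^(ℓ+1), all lines fall into the same one of the three
      -- cases, and `D₀` decides which. When p^ℓ exactly divides `D₀`, the sum becomes the number of
      -- `e i` prime to p.
      ∑-hits : ∀ {m} (D : Fin m → ℤ) (e : Fin m → ℕ.ℕ) (D₀ : ℤ) →
               (∀ i → P (ℕ.suc ℓ) ∣ D i - D₀) →
               p ℕ∣.∣ ∑ (allFin m) (λ i → ind (¬? (+ p ∣? + e i))) →
               p ℕ∣.∣ ∑ (allFin m) (λ i → hits (D i) (e i))
      ∑-hits {m} D e D₀ D≡D₀ p∣count with P (ℕ.suc ℓ) ∣? D₀ | P ℓ ∣? D₀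
      ... | yes 1+ℓ∣D₀ | _ = ∑-∣ (allFin m) λ i → hits-deep (D i) (e i)
              (∣-lin₂ (D≡D₀ i) 1+ℓ∣D₀ 1ℤ 1ℤ (D-split (D i) D₀))
        where
        D-split : ∀ D D₀ → D ≡ 1ℤ * (D - D₀) + 1ℤ * D₀
        D-split = solve-∀
      ... | no 1+ℓ∤D₀ | yes ℓ∣D₀ = subst (p ℕ∣.∣_) (sym (∑-cong (allFin m) λ i →
              hits-shallow (D i) (e i)
                (∣-lin₂ (∣-trans (P-mono (ℕₚ.n≤1+n ℓ)) (D≡D₀ i)) ℓ∣D₀ 1ℤ 1ℤ (D-split (D i) D₀))
                (λ 1+ℓ∣D → 1+ℓ∤D₀ (∣-lin₂ (D≡D₀ i) 1+ℓ∣D (- 1ℤ) 1ℤ (D₀-split (D i) D₀)))))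
              p∣count
        where
        D-split : ∀ D D₀ → D ≡ 1ℤ * (D - D₀) + 1ℤ * D₀
        D-split = solve-∀
        D₀-split : ∀ D D₀ → D₀ ≡ - 1ℤ * (D - D₀) + 1ℤ * D
        D₀-split = solve-∀
      ... | no _ | no ℓ∤D₀ = subst (p ℕ∣.∣_) (sym (∑-zero (allFin m) λ i →
              hits-off (D i) (e i) λ ℓ∣D →
                ℓ∤D₀ (∣-lin₂ (∣-trans (P-mono (ℕₚ.n≤1+n ℓ)) (D≡D₀ i)) ℓ∣D (- 1ℤ) 1ℤ (D₀-split (D i) D₀))))
              (p ℕ∣.∣0)
        where
        D₀-split : ∀ D D₀ → D₀ ≡ - 1ℤ * (D - D₀) + 1ℤ * D
        D₀-split = solve-∀

    -- Counting directions in a plane over the prime field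

    -- Exactly one `e i` vanishes modulo p: two zeros would make a determinant vanish, and having
    -- none would contradict the pigeonhole principle. The zero and nonzero counts add up to p + 1.
    count-nonzero-slopes : (γ : Fin (ℕ.suc p) → ℤ) (e : Fin (ℕ.suc p) → ℕ.ℕ) →
      (∀ i j → i ≢ j → ¬ + p ∣ γ i * + e j - γ j * + e i) →
      ∑ (allFin (ℕ.suc p)) (λ i → ind (¬? (+ p ∣? + e i))) ≡ p
    count-nonzero-slopes γ e indep = ℕₚ.+-cancelʳ-≡ 1 _ p (begin
      ∑ all (λ i → ind (¬? (+ p ∣? + e i))) ℕ.+ 1
        ≡⟨ cong (∑ all (λ i → ind (¬? (+ p ∣? + e i))) ℕ.+_) one-zero ⟨
      ∑ all (λ i → ind (¬? (+ p ∣? + e i))) ℕ.+ ∑ all (λ i → ind (+ p ∣? + e i))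
        ≡⟨ ∑-distrib-+ all (λ i → ind (¬? (+ p ∣? + e i))) (λ i → ind (+ p ∣? + e i)) ⟨
      ∑ all (λ i → ind (¬? (+ p ∣? + e i)) ℕ.+ ind (+ p ∣? + e i))
        ≡⟨ ∑-cong all (λ i → complement (+ p ∣? + e i)) ⟩
      ∑ all (λ _ → 1)
        ≡⟨ ∑-allFin-const (ℕ.suc p) 1 ⟩
      ℕ.suc p ℕ.* 1
        ≡⟨ ℕₚ.*-identityʳ (ℕ.suc p) ⟩
      ℕ.suc p
        ≡⟨ ℕₚ.+-comm 1 p ⟩
      p ℕ.+ 1 ∎)
      where
      open ≡-Reasoning

      all : List (Fin (ℕ.suc p))
      all = allFin (ℕ.suc p)

      complement : {A : Set} (A? : Dec A) → ind (¬? A?) ℕ.+ ind A? ≡ 1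
      complement (yes _) = refl
      complement (no _)  = refl

      -- Otherwise the p + 1 slopes γ i / e i would be pairwise distinct residues.
      zero-slope : ∃ λ i → + p ∣ + e i
      zero-slope with Finₚ.any? (λ i → + p ∣? + e i)
      ... | yes found = found
      ... | no none = contradiction proportional (indep i j (Finₚ.<⇒≢ i<j))
        where
        inv : ∀ i → ∃ λ y → + p ∣ + e i * y - 1ℤ
        inv i = inverse-mod-p (e i) (λ p∣e → none (i , p∣e))

        slope : ∀ i → Σ (Fin p) λ r → + p ∣ + toℕ r - γ i * proj₁ (inv i)
        slope i = residue p (γ i * proj₁ (inv i))

        slope-spec : ∀ i → + p ∣ γ i - + toℕ (proj₁ (slope i)) * + e i
        slope-spec i = ∣-lin₂ (proj₂ (slope i)) (proj₂ (inv i)) (- + e i) (- γ i)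
          (identity (γ i) (+ toℕ (proj₁ (slope i))) (+ e i) (proj₁ (inv i)))
          where
          identity : ∀ g r e y → g - r * e ≡ - e * (r - g * y) + - g * (e * y - 1ℤ)
          identity = solve-∀

        collision = Finₚ.pigeonhole (ℕₚ.n<1+n p) (proj₁ ∘ slope)
        i = proj₁ collision
        j = proj₁ (proj₂ collision)
        i<j = proj₁ (proj₂ (proj₂ collision))

        proportional : + p ∣ γ i * + e j - γ j * + e i
        proportional = ∣-lin₂
          (subst (λ r → + p ∣ γ i - + toℕ r * + e i) (proj₂ (proj₂ (proj₂ collision))) (slope-spec i))
          (slope-spec j) (+ e j) (- + e i)
          (identity (γ i) (γ j) (+ toℕ (proj₁ (slope j))) (+ e i) (+ e j))
          where
          identity : ∀ g h r e f → g * f - h * e ≡ f * (g - r * e) + - e * (h - r * f)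
          identity = solve-∀

      one-zero : ∑ all (λ i → ind (+ p ∣? + e i)) ≡ 1
      one-zero with i , p∣eᵢ ← zero-slope = trans
        (∑-allFin-single _ i λ j j≢i → ind-no
          (λ p∣eⱼ → indep i j (j≢i ∘ sym) (∣m∣n⇒∣m-n (∣n⇒∣m*n (γ i) p∣eⱼ) (∣n⇒∣m*n (γ j) p∣eᵢ)))
          (+ p ∣? + e j))
        (ind-yes p∣eᵢ (+ p ∣? + e i))

    -- Here (r i, s i) are coordinates of the directions in a plane and `e i` is the value of the
    -- linear form (α, β). A form that is zero modulo p gives the count 0. Otherwise one coordinate
    -- is traded for `e`: the determinants of (s, e) are -α times the old ones, those of (r, e) are
    -- β times the old ones, so independence survives.
    count-nonzero-directions :
      (r s : Fin (ℕ.suc p) → ℤ) (e : Fin (ℕ.suc p) → ℕ.ℕ) (α β : ℤ) →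
      (∀ i → + p ∣ + e i - (r i * α + s i * β)) →
      (∀ i j → i ≢ j → ¬ + p ∣ r i * s j - r j * s i) →
      p ℕ∣.∣ ∑ (allFin (ℕ.suc p)) (λ i → ind (¬? (+ p ∣? + e i)))
    count-nonzero-directions r s e α β e≡ indep with + p ∣? α | + p ∣? β
    ... | yes p∣α | yes p∣β = subst (p ℕ∣.∣_) (sym (∑-zero (allFin (ℕ.suc p)) λ i →
            ind-no (λ p∤e → p∤e (∣-lin₃ (e≡ i) p∣α p∣β 1ℤ (r i) (s i)
                     (identity (+ e i) (r i) (s i) α β)))
                   (¬? (+ p ∣? + e i))))
            (p ℕ∣.∣0)
      where
      identity : ∀ e r s α β → e ≡ 1ℤ * (e - (r * α + s * β)) + r * α + s * β
      identity = solve-∀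
    ... | no p∤α | _ = subst (p ℕ∣.∣_) (sym (count-nonzero-slopes s e λ i j i≢j p∣ →
            indep i j i≢j (p-cancelˡ α p∤α (∣-lin₃ p∣ (e≡ j) (e≡ i) (- 1ℤ) (s i) (- s j)
              (identity (r i) (r j) (s i) (s j) (+ e i) (+ e j) α β))))) ℕ∣.∣-refl
      where
      identity : ∀ r r′ s s′ e e′ α β → α * (r * s′ - r′ * s)
               ≡ - 1ℤ * (s * e′ - s′ * e) + s * (e′ - (r′ * α + s′ * β)) + - s′ * (e - (r * α + s * β))
      identity = solve-∀
    ... | _ | no p∤β = subst (p ℕ∣.∣_) (sym (count-nonzero-slopes r e λ i j i≢j p∣ →
            indep i j i≢j (p-cancelˡ β p∤β (∣-lin₃ p∣ (e≡ j) (e≡ i) 1ℤ (- r i) (r j)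
              (identity (r i) (r j) (s i) (s j) (+ e i) (+ e j) α β))))) ℕ∣.∣-refl
      where
      identity : ∀ r r′ s s′ e e′ α β → β * (r * s′ - r′ * s)
               ≡ 1ℤ * (r * e′ - r′ * e) + - r * (e′ - (r′ * α + s′ * β)) + r′ * (e - (r * α + s * β))
      identity = solve-∀

    -- Linear algebra modulo p

    minor : {I : Set} → (I → ℤ) → (I → ℤ) → I → I → ℤ
    minor x y c d = x c * y d - x d * y c

    -- Cramer's rule: eliminating `s` between the coordinates c and d leaves the minor times `r`,
    -- and the minor is prime to p.
    minor≢0⇒∣ : ∀ {I : Set} m (x y : I → ℤ) (r s : ℤ) {c d} → ¬ + p ∣ minor x y c d →
                (∀ c → P m ∣ r * x c - s * y c) → P m ∣ r
    minor≢0⇒∣ m x y r s {c} {d} nz rx≡sy = P-cancelˡ m (minor x y c d) nz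
      (∣-lin₂ (rx≡sy c) (rx≡sy d) (y d) (- y c) (identity (x c) (x d) (y c) (y d) r s))
      where
      identity : ∀ x x′ y y′ r s →
                 (x * y′ - x′ * y) * r ≡ y′ * (r * x - s * y) + - y * (r * x′ - s * y′)
      identity = solve-∀

    -- Modulo p, the minor of x and y is the minor of u and v times the determinant of the
    -- coefficients. Read contrapositively, it carries independence of directions over to their
    -- coordinates in the plane.
    minor-span : ∀ {I : Set} (x y u v : I → ℤ) (r s r′ s′ : ℤ) {c d} →
                 (∀ c → + p ∣ x c - (r * u c + s * v c)) →
                 (∀ c → + p ∣ y c - (r′ * u c + s′ * v c)) →
                 + p ∣ r * s′ - r′ * s → + p ∣ minor x y c d
    minor-span x y u v r s r′ s′ {c} {d} x≡ y≡ p∣det =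
      ∣-lin₃ (*-cong {x c} {r * u c + s * v c} {y d} {r′ * u d + s′ * v d} (x≡ c) (y≡ d))
             (*-cong {x d} {r * u d + s * v d} {y c} {r′ * u c + s′ * v c} (x≡ d) (y≡ c))
             (∣-lin₁ p∣det (minor u v c d) (identity₂ (u c) (u d) (v c) (v d) r s r′ s′))
             1ℤ (- 1ℤ) 1ℤ (identity₁ (x c * y d) (x d * y c)
               ((r * u c + s * v c) * (r′ * u d + s′ * v d)) ((r * u d + s * v d) * (r′ * u c + s′ * v c)))
      where
      *-cong : ∀ {x a y b} → + p ∣ x - a → + p ∣ y - b → + p ∣ x * y - a * b
      *-cong {x} {a} {y} {b} x≡a y≡b = ∣-lin₂ x≡a y≡b y a (identity x a y b)
        where
        identity : ∀ x a y b → x * y - a * b ≡ y * (x - a) + a * (y - b)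
        identity = solve-∀

      identity₁ : ∀ w w′ z z′ → w - w′ ≡ 1ℤ * (w - z) + - 1ℤ * (w′ - z′) + 1ℤ * (z - z′)
      identity₁ = solve-∀

      identity₂ : ∀ u u′ v v′ r s r′ s′ →
        (r * u + s * v) * (r′ * u′ + s′ * v′) - (r * u′ + s * v′) * (r′ * u + s′ * v)
        ≡ (u * v′ - u′ * v) * (r * s′ - r′ * s)
      identity₂ = solve-∀

    -- Since u and v are independent modulo p, the coefficients of a multiple of
    -- p^ℓ are themselves multiples of p^ℓ.
    span-÷ : ∀ {I : Set} ℓ (b u v : I → ℤ) (ρ σ : ℤ) {c d} → ¬ + p ∣ minor u v c d →
             (∀ c → P (ℕ.suc ℓ) ∣ P ℓ * b c - (ρ * u c + σ * v c)) →
             ∃₂ λ r s → ∀ c → + p ∣ b c - (r * u c + s * v c)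
    span-÷ ℓ b u v ρ σ {c} {d} nz direction = quotients ℓ∣ρ ℓ∣σ
      where
      combination≡0 : ∀ c → P ℓ ∣ ρ * u c + σ * v c
      combination≡0 c = ∣-lin₂ (∣-trans (P-mono (ℕₚ.n≤1+n ℓ)) (direction c)) (∣-refl {P ℓ})
        (- 1ℤ) (b c) (identity (P ℓ) (b c) (ρ * u c + σ * v c))
        where
        identity : ∀ m b z → z ≡ - 1ℤ * (m * b - z) + b * m
        identity = solve-∀

      ℓ∣ρ : P ℓ ∣ ρ
      ℓ∣ρ = minor≢0⇒∣ ℓ u v ρ (- σ) {c} {d} nz λ c →
        ∣-lin₁ (combination≡0 c) 1ℤ (identity ρ σ (u c) (v c))
        where
        identity : ∀ r s u v → r * u - - s * v ≡ 1ℤ * (r * u + s * v)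
        identity = solve-∀

      -- The same elimination with u and v exchanged; exchanging c and d too keeps the value of the
      -- minor.
      ℓ∣σ : P ℓ ∣ σ
      ℓ∣σ = minor≢0⇒∣ ℓ v u σ (- ρ) {d} {c}
        (λ p∣ → nz (∣-lin₁ p∣ 1ℤ (identity₁ (u c) (u d) (v c) (v d)))) λ c →
        ∣-lin₁ (combination≡0 c) 1ℤ (identity₂ ρ σ (u c) (v c))
        where
        identity₁ : ∀ u u′ v v′ → u * v′ - u′ * v ≡ 1ℤ * (v′ * u - v * u′)
        identity₁ = solve-∀
        identity₂ : ∀ r s u v → s * v - - r * u ≡ 1ℤ * (r * u + s * v)
        identity₂ = solve-∀

      quotients : P ℓ ∣ ρ → P ℓ ∣ σ → ∃₂ λ r s → ∀ c → + p ∣ b c - (r * u c + s * v c)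
      quotients (divides r ρ≡) (divides s σ≡) = r , s , λ c → *-cancelʳ-∣ (P ℓ) {{p^m≢0 ℓ}}
        (subst₂ _∣_ (P-suc ℓ)
          (trans (cong₂ (λ z w → P ℓ * b c - (z * u c + w * v c)) ρ≡ σ≡)
                 (identity (P ℓ) (b c) r s (u c) (v c)))
          (direction c))
        where
        identity : ∀ m b r s u v → m * b - (r * m * u + s * m * v) ≡ (b - (r * u + s * v)) * m
        identity = solve-∀

    -- Arbitrary integer vectors are allowed, since the spanning vectors of a plane need not be
    -- given by canonical residues.
    dotℤ : {I : Set} → List I → (I → ℤ) → (I → ℤ) → ℤ
    dotℤ []       x b = 0ℤ
    dotℤ (i ∷ is) x b = x i * b i + dotℤ is x b

    dotℤ-linear : ∀ {I : Set} {m} (is : List I) (x y w b : I → ℤ) (r s : ℤ) →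
                  (∀ i → m ∣ x i - (r * y i + s * w i)) →
                  m ∣ dotℤ is x b - (r * dotℤ is y b + s * dotℤ is w b)
    dotℤ-linear []       x y w b r s x≡ = divides 0ℤ (identity r s)
      where
      identity : ∀ r s → 0ℤ - (r * 0ℤ + s * 0ℤ) ≡ 0ℤ
      identity = solve-∀
    dotℤ-linear (i ∷ is) x y w b r s x≡ =
      ∣-lin₂ (x≡ i) (dotℤ-linear is x y w b r s x≡) (b i) 1ℤ
        (identity (x i) (y i) (w i) (b i) (dotℤ is x b) (dotℤ is y b) (dotℤ is w b) r s)
      where
      identity : ∀ x y w b X Y W r s → x * b + X - (r * (y * b + Y) + s * (w * b + W))
                 ≡ b * (x - (r * y + s * w)) + 1ℤ * (X - (r * Y + s * W))
      identity = solve-∀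

    -- Points of R^n as integer vectors, and canonical directions.

    module _ (k : ℕ.ℕ) where

      ⟦_⟧ : ∀ {n} → Pt p k n → Fin n → ℤ
      ⟦ x ⟧ c = + toℕ (x c)

      +-dot : ∀ {n} (x b : Pt p k n) → + dot x b ≡ dotℤ (allFin n) ⟦ x ⟧ ⟦ b ⟧
      +-dot {n} x b = go (allFin n)
        where
        go : ∀ is → + sum (map (λ i → toℕ (x i) ℕ.* toℕ (b i)) is) ≡ dotℤ is ⟦ x ⟧ ⟦ b ⟧
        go []       = refl
        go (i ∷ is) = cong₂ _+_ (ℤₚ.pos-* (toℕ (x i)) (toℕ (b i))) (go is)

      dot-linear : ∀ {n m} (x y w b : Pt p k n) (r s : ℤ) →
                   (∀ c → m ∣ ⟦ x ⟧ c - (r * ⟦ y ⟧ c + s * ⟦ w ⟧ c)) →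
                   m ∣ + dot x b - (r * + dot y b + s * + dot w b)
      dot-linear {n} {m} x y w b r s x≡ =
        subst (m ∣_) (sym (cong₂ _-_ (+-dot x b)
                       (cong₂ (λ Y W → r * Y + s * W) (+-dot y b) (+-dot w b))))
          (dotℤ-linear (allFin n) ⟦ x ⟧ ⟦ y ⟧ ⟦ w ⟧ ⟦ b ⟧ r s x≡)

      pivot : ∀ {n} (b : Pt p k n) → InB p k b → ∃ λ i → P k ∣ ⟦ b ⟧ i - 1ℤ
      pivot b (i , bᵢ≡1 , _) = i , ModEq⇒∣ (toℕ (b i)) 1 bᵢ≡1

      -- Distinct canonical directions modulo p are distinct points of projective space.
      independent : ∀ {n} (b b′ : Pt p k n) → 0 ℕ.< k → InB p k b → InB p k b′ →
                    AngleOne p k b b′ → ∃₂ λ c d → ¬ + p ∣ minor ⟦ b ⟧ ⟦ b′ ⟧ c d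
      independent {n} b b′ 0<k b∈B b′∈B angle =
        cases (ℕₚ.<-cmp (toℕ i) (toℕ i′))
        where
        i  = proj₁ b∈B
        i′ = proj₁ b′∈B

        p∣P : + p ∣ P k
        p∣P = subst (λ m → + m ∣ P k) (ℕₚ.*-identityʳ p) (P-mono 0<k)

        bᵢ≡1 : + p ∣ ⟦ b ⟧ i - 1ℤ
        bᵢ≡1 = ∣-trans p∣P (proj₂ (pivot b b∈B))

        b′ᵢ≡1 : + p ∣ ⟦ b′ ⟧ i′ - 1ℤ
        b′ᵢ≡1 = ∣-trans p∣P (proj₂ (pivot b′ b′∈B))

        -- The 2 × 2 block is triangular with unit diagonal modulo p, so its minor is 1.
        triangular : ∀ (x y : Fin n → ℤ) i j → + p ∣ x i - 1ℤ → + p ∣ y j - 1ℤ → + p ∣ y i →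
                     ¬ + p ∣ minor x y i j
        triangular x y i j xᵢ≡1 yⱼ≡1 yᵢ≡0 minor≡0 =
          p∤1 (∣-lin₄ minor≡0 xᵢ≡1 yⱼ≡1 yᵢ≡0 1ℤ (- y j) (- 1ℤ) (x j)
                (identity (x i) (x j) (y i) (y j)))
          where
          identity : ∀ x x′ y y′ → 1ℤ ≡ 1ℤ * (x * y′ - x′ * y) + - y′ * (x - 1ℤ)
                                        + - 1ℤ * (y′ - 1ℤ) + x′ * y
          identity = solve-∀

        cases : Tri (toℕ i ℕ.< toℕ i′) (toℕ i ≡ toℕ i′) (toℕ i′ ℕ.< toℕ i) →
                ∃₂ λ c d → ¬ + p ∣ minor ⟦ b ⟧ ⟦ b′ ⟧ c d
        cases (tri< i<i′ _ _) = i , i′ ,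
          triangular ⟦ b ⟧ ⟦ b′ ⟧ i i′ bᵢ≡1 b′ᵢ≡1 (∣ᵤ⇒∣ (proj₂ (proj₂ b′∈B) i i<i′))
        cases (tri> _ _ i′<i) = i , i′ , λ minor≡0 →
          triangular ⟦ b′ ⟧ ⟦ b ⟧ i′ i b′ᵢ≡1 bᵢ≡1 (∣ᵤ⇒∣ (proj₂ (proj₂ b∈B) i′ i′<i))
            (∣-lin₁ minor≡0 1ℤ (identity (⟦ b ⟧ i) (⟦ b ⟧ i′) (⟦ b′ ⟧ i) (⟦ b′ ⟧ i′)))
          where
          identity : ∀ x x′ y y′ → y′ * x - y * x′ ≡ 1ℤ * (x * y′ - x′ * y)
          identity = solve-∀
        -- With a common pivot both vectors are 1 there, so the minor against j reduces to b′ⱼ - bⱼ;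
        -- the angle condition supplies a j where this is nonzero modulo p.
        cases (tri≈ _ i≡i′ _)
          with j , bⱼ≢b′ⱼ ← Finₚ.¬∀⟶∃¬ n _ (λ c → modEq? p (toℕ (b c)) (toℕ (b′ c))) angle =
          i , j , λ minor≡0 → bⱼ≢b′ⱼ (∣⇒ModEq (toℕ (b j)) (toℕ (b′ j))
            (∣-lin₃ minor≡0 bᵢ≡1 (subst (λ i → + p ∣ ⟦ b′ ⟧ i - 1ℤ) (sym (Finₚ.toℕ-injective i≡i′)) b′ᵢ≡1)
              (- 1ℤ) (⟦ b′ ⟧ j) (- ⟦ b ⟧ j)
              (identity (⟦ b ⟧ i) (⟦ b ⟧ j) (⟦ b′ ⟧ i) (⟦ b′ ⟧ j))))
          where
          identity : ∀ x x′ y y′ → x′ - y′ ≡ - 1ℤ * (x * y′ - x′ * y) + y′ * (x - 1ℤ) + - x′ * (y - 1ℤ)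
          identity = solve-∀

      -- The points of a fan.

      module FanCount {n : ℕ.ℕ} (F : Fan p k n) where

        open Fan F
        open LineCount k ℓ ℓ≤k-2

        0<k : 0 ℕ.< k
        0<k = ℕₚ.≤-trans (ℕ.s≤s ℕ.z≤n) 1+ℓ≤k

        base : Fin (ℕ.suc p) → Pt p k n
        base i = proj₁ (meetsQ i)

        base≡a : ∀ i c → P (ℕ.suc ℓ) ∣ ⟦ base i ⟧ c - ⟦ a ⟧ c
        base≡a i c = ModEq⇒∣ (toℕ (base i c)) (toℕ (a c)) (proj₂ (proj₂ (meetsQ i)) c)

        base≡c' : ∀ i c → P ℓ ∣ ⟦ base i ⟧ c - ⟦ c' ⟧ c
        base≡c' i c = ∣-lin₂ (∣-trans (P-mono (ℕₚ.n≤1+n ℓ)) (base≡a i c))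
          (ModEq⇒∣ (toℕ (a c)) (toℕ (c' c)) (a∈Q' c)) 1ℤ 1ℤ (identity (⟦ base i ⟧ c) (⟦ a ⟧ c) (⟦ c' ⟧ c))
          where
          identity : ∀ x a c → x - c ≡ 1ℤ * (x - a) + 1ℤ * (a - c)
          identity = solve-∀

        -- Line i is rebased at its point `base i` of Q, so that membership in Q and Q' can be read
        -- off the power of p dividing t.
        At : Fin (ℕ.suc p) → ℤ → Pt p k n → Set
        At i t x = ∀ c → P k ∣ ⟦ x ⟧ c - (⟦ base i ⟧ c + t * ⟦ lb i ⟧ c)

        point : ∀ i t → ∃ (At i t)
        point i t = (λ c → proj₁ (r c)) , (λ c → proj₂ (r c))
          where
          r : ∀ c → Σ (Fin (p ℕ.^ k)) λ r → P k ∣ + toℕ r - (⟦ base i ⟧ c + t * ⟦ lb i ⟧ c)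
          r c = residue (p ℕ.^ k) {{p^m≢0 k}} (⟦ base i ⟧ c + t * ⟦ lb i ⟧ c)

        At-unique : ∀ i t {x y} → At i t x → At i t y → x ≗ y
        At-unique i t {x} {y} x∈ y∈ c = residue-unique (x c) (y c)
          (∣-lin₂ (x∈ c) (y∈ c) 1ℤ (- 1ℤ) (identity (⟦ x ⟧ c) (⟦ y ⟧ c) (⟦ base i ⟧ c + t * ⟦ lb i ⟧ c)))
          where
          identity : ∀ x y z → x - y ≡ 1ℤ * (x - z) + - 1ℤ * (y - z)
          identity = solve-∀

        At-resp : ∀ i t {x y} → x ≗ y → At i t x → At i t y
        At-resp i t x≗y x∈ c = subst (λ r → P k ∣ + toℕ r - (⟦ base i ⟧ c + t * ⟦ lb i ⟧ c)) (x≗y c) (x∈ c)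

        OnLine⇒∣ : ∀ {i x} ((t , _) : OnLine p k (la i) (lb i) x) → ∀ c →
                   P k ∣ ⟦ x ⟧ c - (⟦ la i ⟧ c + + toℕ t * ⟦ lb i ⟧ c)
        OnLine⇒∣ {i} {x} (t , x∈) c = subst (λ z → P k ∣ ⟦ x ⟧ c - (⟦ la i ⟧ c + z)) (ℤₚ.pos-* (toℕ t) (toℕ (lb i c)))
          (ModEq⇒∣ (toℕ (x c)) (toℕ (la i c) ℕ.+ toℕ t ℕ.* toℕ (lb i c)) (x∈ c))

        OnLine⇒At : ∀ {i x} → OnLine p k (la i) (lb i) x → ∃ λ (t : Fin (p ℕ.^ k)) → At i (+ toℕ t) x
        OnLine⇒At {i} {x} x∈ = t , λ c →
          ∣-lin₃ (OnLine⇒∣ x∈ c) (OnLine⇒∣ base∈ c) (proj₂ diff) 1ℤ (- 1ℤ) (- ⟦ lb i ⟧ c)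
            (identity (⟦ x ⟧ c) (⟦ base i ⟧ c) (⟦ la i ⟧ c) (⟦ lb i ⟧ c) (+ toℕ t) (+ toℕ (proj₁ x∈)) (+ toℕ (proj₁ base∈)))
          where
          base∈ = proj₁ (proj₂ (meetsQ i))
          diff = residue (p ℕ.^ k) {{p^m≢0 k}} (+ toℕ (proj₁ x∈) - + toℕ (proj₁ base∈))
          t = proj₁ diff
          identity : ∀ x y l b t t₁ t₀ → x - (y + t * b)
            ≡ 1ℤ * (x - (l + t₁ * b)) + - 1ℤ * (y - (l + t₀ * b)) + - b * (t - (t₁ - t₀))
          identity = solve-∀

        At⇒OnLine : ∀ {i t x} → At i t x → OnLine p k (la i) (lb i) x
        At⇒OnLine {i} {t} {x} x∈ = s , λ c →
          ∣⇒ModEq (toℕ (x c)) (toℕ (la i c) ℕ.+ toℕ s ℕ.* toℕ (lb i c))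
            (subst (λ z → P k ∣ ⟦ x ⟧ c - (⟦ la i ⟧ c + z)) (sym (ℤₚ.pos-* (toℕ s) (toℕ (lb i c))))
              (∣-lin₃ (x∈ c) (OnLine⇒∣ base∈ c) (proj₂ total) 1ℤ 1ℤ (- ⟦ lb i ⟧ c)
                (identity (⟦ x ⟧ c) (⟦ base i ⟧ c) (⟦ la i ⟧ c) (⟦ lb i ⟧ c) t (+ toℕ s) (+ toℕ (proj₁ base∈)))))
          where
          base∈ = proj₁ (proj₂ (meetsQ i))
          total = residue (p ℕ.^ k) {{p^m≢0 k}} (+ toℕ (proj₁ base∈) + t)
          s = proj₁ total
          identity : ∀ x y l b t s t₀ → x - (l + s * b)
            ≡ 1ℤ * (x - (y + t * b)) + 1ℤ * (y - (l + t₀ * b)) + - b * (s - (t₀ + t))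
          identity = solve-∀

        -- At a coordinate where the direction is 1, the difference x - `base i` is t itself.
        InCube⇒∣ : ∀ {m i t x z} → m ℕ.≤ k → (∀ c → P m ∣ ⟦ base i ⟧ c - ⟦ z ⟧ c) →
                   At i t x → InCube p k m z x → P m ∣ t
        InCube⇒∣ {m} {i} {t} {x} {z} m≤k base≡z x∈ x∈Q with c , b≡1 ← pivot (lb i) (lb∈B i) =
          ∣-lin₄ (ModEq⇒∣ (toℕ (x c)) (toℕ (z c)) (x∈Q c)) (base≡z c)
            (∣-trans (P-mono m≤k) (x∈ c)) (∣-trans (P-mono m≤k) b≡1) 1ℤ (- 1ℤ) (- 1ℤ) (- t)
            (identity (⟦ x ⟧ c) (⟦ z ⟧ c) (⟦ base i ⟧ c) (⟦ lb i ⟧ c) t)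
          where
          identity : ∀ x z y b t → t ≡ 1ℤ * (x - z) + - 1ℤ * (y - z) + - 1ℤ * (x - (y + t * b)) + - t * (b - 1ℤ)
          identity = solve-∀

        ∣⇒InCube : ∀ {m i t x z} → m ℕ.≤ k → (∀ c → P m ∣ ⟦ base i ⟧ c - ⟦ z ⟧ c) →
                   At i t x → P m ∣ t → InCube p k m z x
        ∣⇒InCube {m} {i} {t} {x} {z} m≤k base≡z x∈ m∣t c = ∣⇒ModEq (toℕ (x c)) (toℕ (z c))
          (∣-lin₃ (∣-trans (P-mono m≤k) (x∈ c)) (base≡z c) m∣t 1ℤ 1ℤ (⟦ lb i ⟧ c)
            (identity (⟦ x ⟧ c) (⟦ z ⟧ c) (⟦ base i ⟧ c) (⟦ lb i ⟧ c) t))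
          where
          identity : ∀ x z y b t → x - z ≡ 1ℤ * (x - (y + t * b)) + 1ℤ * (y - z) + b * t
          identity = solve-∀

        -- On one line, the pivot coordinate determines t. On two lines, both bases agree with `a`
        -- modulo p^(ℓ+1), so a common point gives t bᵢ ≡ s bⱼ; independence then forces p^(ℓ+1) ∣
        -- t, so lines can meet only inside Q.
        At-injective : ∀ {i j x} {t s : Fin (p ℕ.^ k)} → At i (+ toℕ t) x → At j (+ toℕ s) x →
                       ¬ P (ℕ.suc ℓ) ∣ + toℕ t → i ≡ j × t ≡ s
        At-injective {i} {j} {x} {t} {s} x∈i x∈j 1+ℓ∤t with i Finₚ.≟ j
        ... | yes refl with c , b≡1 ← pivot (lb i) (lb∈B i) = refl , residue-unique t s
            (∣-lin₃ (x∈i c) (x∈j c) b≡1 (- 1ℤ) 1ℤ (- (+ toℕ t - + toℕ s))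
              (identity (⟦ x ⟧ c) (⟦ base i ⟧ c) (⟦ lb i ⟧ c) (+ toℕ t) (+ toℕ s)))
          where
          identity : ∀ x y b t s → t - s
            ≡ - 1ℤ * (x - (y + t * b)) + 1ℤ * (x - (y + s * b)) + - (t - s) * (b - 1ℤ)
          identity = solve-∀
        ... | no i≢j with c , d , nz ← independent (lb i) (lb j) 0<k (lb∈B i) (lb∈B j) (angles i j i≢j) =
            contradiction (minor≢0⇒∣ (ℕ.suc ℓ) ⟦ lb i ⟧ ⟦ lb j ⟧ (+ toℕ t) (+ toℕ s) nz λ c →
              ∣-lin₄ (∣-trans (P-mono 1+ℓ≤k) (x∈i c)) (∣-trans (P-mono 1+ℓ≤k) (x∈j c))
                (base≡a i c) (base≡a j c) (- 1ℤ) 1ℤ (- 1ℤ) 1ℤ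
                (identity (⟦ x ⟧ c) (⟦ base i ⟧ c) (⟦ base j ⟧ c) (⟦ a ⟧ c) (⟦ lb i ⟧ c) (⟦ lb j ⟧ c) (+ toℕ t) (+ toℕ s)))
              1+ℓ∤t
          where
          identity : ∀ x y y′ a b b′ t s → t * b - s * b′
            ≡ - 1ℤ * (x - (y + t * b)) + 1ℤ * (x - (y′ + s * b′)) + - 1ℤ * (y - a) + 1ℤ * (y′ - a)
          identity = solve-∀

        dot-At : ∀ i t x b → At i t x → P k ∣ + dot x b - (1ℤ * + dot (base i) b + t * + dot (lb i) b)
        dot-At i t x b x∈ = dot-linear x (base i) (lb i) b 1ℤ t λ c →
          ∣-lin₁ (x∈ c) 1ℤ (identity (⟦ x ⟧ c) (⟦ base i ⟧ c) (⟦ lb i ⟧ c) t)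
          where
          identity : ∀ x y b t → x - (1ℤ * y + t * b) ≡ 1ℤ * (x - (y + t * b))
          identity = solve-∀

        -- The form in which both definitions of a fan enter the count: modulo p, all directions lie
        -- in the span of two vectors.
        Coplanar : Set
        Coplanar = ∃₂ λ (u v : Fin n → ℤ) → ∀ i → ∃₂ λ r s → ∀ c → + p ∣ ⟦ lb i ⟧ c - (r * u c + s * v c)

        -- The point of line i at parameter p^ℓ lies in Q', hence near the plane. Subtracting `a`
        -- modulo p^(ℓ+1) puts p^ℓ bᵢ into the span of u and v, and `span-÷` divides by p^ℓ.
        plane⇒coplanar : ∀ u v → InB p k u → InB p k v → AngleOne p k u v →
          (∀ j x → OnLine p k (la j) (lb j) x → InCube p k ℓ c' x →
             InCube p k ℓ c' x × InNbhdPlane p k (ℕ.suc ℓ) a u v x) →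
          Coplanar
        plane⇒coplanar u v u∈B v∈B angle L⊆Π = ⟦ u ⟧ , ⟦ v ⟧ , λ i →
          span-÷ ℓ ⟦ lb i ⟧ ⟦ u ⟧ ⟦ v ⟧ (+ toℕ (ρ i)) (+ toℕ (σ i))
            (proj₂ (proj₂ (independent u v 0<k u∈B v∈B angle))) (direction i)
          where
          y : Fin (ℕ.suc p) → Pt p k n
          y i = proj₁ (point i (P ℓ))

          y∈ : ∀ i → At i (P ℓ) (y i)
          y∈ i = proj₂ (point i (P ℓ))

          y∈Π : ∀ i → InNbhdPlane p k (ℕ.suc ℓ) a u v (y i)
          y∈Π i = proj₂ (L⊆Π i (y i) (At⇒OnLine {t = P ℓ} (y∈ i))
                    (∣⇒InCube {t = P ℓ} {z = c'} ℓ≤k (base≡c' i) (y∈ i) ∣-refl))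

          ρ σ : Fin (ℕ.suc p) → Fin (p ℕ.^ k)
          ρ i = proj₁ (y∈Π i)
          σ i = proj₁ (proj₂ (y∈Π i))

          direction : ∀ i c → P (ℕ.suc ℓ) ∣
            P ℓ * ⟦ lb i ⟧ c - (+ toℕ (ρ i) * ⟦ u ⟧ c + + toℕ (σ i) * ⟦ v ⟧ c)
          direction i c = ∣-lin₃
            (subst₂ (λ z w → P (ℕ.suc ℓ) ∣ ⟦ y i ⟧ c - (⟦ a ⟧ c + z + w))
              (ℤₚ.pos-* (toℕ (ρ i)) (toℕ (u c))) (ℤₚ.pos-* (toℕ (σ i)) (toℕ (v c)))
              (ModEq⇒∣ (toℕ (y i c)) (toℕ (a c) ℕ.+ toℕ (ρ i) ℕ.* toℕ (u c) ℕ.+ toℕ (σ i) ℕ.* toℕ (v c))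
                (proj₂ (proj₂ (y∈Π i)) c)))
            (∣-trans (P-mono 1+ℓ≤k) (y∈ i c)) (base≡a i c) 1ℤ (- 1ℤ) (- 1ℤ)
            (identity (⟦ y i ⟧ c) (⟦ a ⟧ c) (⟦ base i ⟧ c) (P ℓ * ⟦ lb i ⟧ c)
              (+ toℕ (ρ i) * ⟦ u ⟧ c) (+ toℕ (σ i) * ⟦ v ⟧ c))
            where
            identity : ∀ y a x b U V → b - (U + V)
              ≡ 1ℤ * (y - (a + U + V)) + - 1ℤ * (y - (x + b)) + - 1ℤ * (x - a)
            identity = solve-∀

        -- On the plane the form ⟨·, b⟩ is determined by its values on u and v, which become the
        -- coefficients α and β.
        directions-count : Coplanar → ∀ b →
          p ℕ∣.∣ ∑ (allFin (ℕ.suc p)) (λ i → ind (¬? (+ p ∣? + dot (lb i) b)))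
        directions-count (u , v , span) b = count-nonzero-directions r s (λ i → dot (lb i) b)
          (dotℤ (allFin n) u ⟦ b ⟧) (dotℤ (allFin n) v ⟦ b ⟧)
          (λ i → subst (λ z → + p ∣ z - (r i * dotℤ (allFin n) u ⟦ b ⟧ + s i * dotℤ (allFin n) v ⟦ b ⟧))
            (sym (+-dot (lb i) b))
            (dotℤ-linear (allFin n) ⟦ lb i ⟧ u v ⟦ b ⟧ (r i) (s i) (lb≡ i)))
          independent-coefficients
          where
          r s : Fin (ℕ.suc p) → ℤ
          r i = proj₁ (span i)
          s i = proj₁ (proj₂ (span i))

          lb≡ : ∀ i c → + p ∣ ⟦ lb i ⟧ c - (r i * u c + s i * v c)
          lb≡ i = proj₂ (proj₂ (span i))

          independent-coefficients : ∀ i j → i ≢ j → ¬ + p ∣ r i * s j - r j * s i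
          independent-coefficients i j i≢j p∣det
            with c , d , nz ← independent (lb i) (lb j) 0<k (lb∈B i) (lb∈B j) (angles i j i≢j) =
            nz (minor-span ⟦ lb i ⟧ ⟦ lb j ⟧ u v (r i) (s i) (r j) (s j) (lb≡ i) (lb≡ j) p∣det)

        -- The pairs (i, t) satisfying `Hit` correspond one to one to the points of X ∩ H, which
        -- turns the count into the double sum treated by `∑-hits`.
        hyperplane-count : Coplanar → ∀ α b →
          p ℕ∣.∣ ∑ (allPoints n (p ℕ.^ k)) (λ x → ind (inHyp? p k α b x ×-dec inFan? p k F x))
        hyperplane-count coplanar α b = subst (p ℕ∣.∣_)
          (sym (count-parametrised
            (λ x → inHyp? p k α b x ×-dec inFan? p k F x)
            (λ i t → hit? (D i) (e i) (toℕ t))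
            pt param sound inj))
          (∑-hits D e (+ dot a b - + dot α b) D≡D₀ (directions-count coplanar b))
          where
          D : Fin (ℕ.suc p) → ℤ
          D i = + dot (base i) b - + dot α b

          e : Fin (ℕ.suc p) → ℕ.ℕ
          e i = dot (lb i) b

          pt : Fin (ℕ.suc p) → Fin (p ℕ.^ k) → Pt p k n
          pt i t = proj₁ (point i (+ toℕ t))

          pt∈ : ∀ i t → At i (+ toℕ t) (pt i t)
          pt∈ i t = proj₂ (point i (+ toℕ t))

          D≡D₀ : ∀ i → P (ℕ.suc ℓ) ∣ D i - (+ dot a b - + dot α b)
          D≡D₀ i = ∣-lin₁
            -- Linearity is used as plain congruence: `base i` ≡ 1 · a + 0 · a, the second summand
            -- being padding.
            (dot-linear (base i) a a b 1ℤ 0ℤ λ c →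
              ∣-lin₁ (base≡a i c) 1ℤ (identity₁ (⟦ base i ⟧ c) (⟦ a ⟧ c)))
            1ℤ (identity₂ (+ dot (base i) b) (+ dot a b) (+ dot α b))
            where
            identity₁ : ∀ x a → x - (1ℤ * a + 0ℤ * a) ≡ 1ℤ * (x - a)
            identity₁ = solve-∀
            identity₂ : ∀ x a z → x - z - (a - z) ≡ 1ℤ * (x - (1ℤ * a + 0ℤ * a))
            identity₂ = solve-∀

          param : ∀ {x} → InHyp p k α b x × InFan p k F x →
                  ∃₂ λ i t → x ≗ pt i t × Hit (D i) (e i) (toℕ t)
          param {x} (x∈H , (i , x∈L , x∈Q') , x∉Q) =
            i , t , At-unique i (+ toℕ t) x∈ (pt∈ i t) , hit
              (InCube⇒∣ {i = i} {t = + toℕ t} {x = x} {z = c'} ℓ≤k (base≡c' i) x∈ x∈Q')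
              (λ 1+ℓ∣t → x∉Q (∣⇒InCube {i = i} {t = + toℕ t} {z = a} 1+ℓ≤k (base≡a i) x∈ 1+ℓ∣t))
              (∣-lin₂ (ModEq⇒∣ (dot x b) (dot α b) x∈H) (dot-At i (+ toℕ t) x b x∈) 1ℤ (- 1ℤ)
                (identity (+ dot x b) (+ dot α b) (+ dot (base i) b) (+ toℕ t) (+ e i)))
            where
            t : Fin (p ℕ.^ k)
            t = proj₁ (OnLine⇒At {i} {x} x∈L)

            x∈ : At i (+ toℕ t) x
            x∈ = proj₂ (OnLine⇒At {i} {x} x∈L)

            identity : ∀ x z y t e → y - z + t * e ≡ 1ℤ * (x - z) + - 1ℤ * (x - (1ℤ * y + t * e))
            identity = solve-∀

          sound : ∀ {x i t} → x ≗ pt i t → Hit (D i) (e i) (toℕ t) → InHyp p k α b x × InFan p k F x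
          sound {x} {i} {t} x≗pt (hit ℓ∣t 1+ℓ∤t on) =
            ∣⇒ModEq (dot x b) (dot α b) (∣-lin₂ on (dot-At i (+ toℕ t) x b x∈) 1ℤ 1ℤ
              (identity (+ dot x b) (+ dot α b) (+ dot (base i) b) (+ toℕ t) (+ e i))) ,
            (i , At⇒OnLine {t = + toℕ t} x∈ , ∣⇒InCube {t = + toℕ t} {z = c'} ℓ≤k (base≡c' i) x∈ ℓ∣t) ,
            (λ x∈Q → 1+ℓ∤t (InCube⇒∣ {t = + toℕ t} {z = a} 1+ℓ≤k (base≡a i) x∈ x∈Q))
            where
            x∈ : At i (+ toℕ t) x
            x∈ = At-resp i (+ toℕ t) (λ c → sym (x≗pt c)) (pt∈ i t)

            identity : ∀ x z y t e → x - z ≡ 1ℤ * (y - z + t * e) + 1ℤ * (x - (1ℤ * y + t * e))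
            identity = solve-∀

          inj : ∀ {i j t s} → Hit (D i) (e i) (toℕ t) → Hit (D j) (e j) (toℕ s) →
                pt i t ≗ pt j s → i ≡ j × t ≡ s
          inj {i} {j} {t} {s} (hit _ 1+ℓ∤t _) _ pt≗pt = At-injective {x = pt j s}
            (At-resp i (+ toℕ t) pt≗pt (pt∈ i t)) (pt∈ j s) 1+ℓ∤t

      coplanar : ∀ {n} → 2 ℕ.≤ n → (F : Fan p k n) → FanCount.Coplanar F
      coplanar {ℕ.suc ℕ.zero} (ℕ.s≤s ()) F
      coplanar {ℕ.suc (ℕ.suc ℕ.zero)} _ F =
        -- In dimension 2 the standard basis spans everything, with the coordinates of each
        -- direction as coefficients.
        (λ { zero → 1ℤ ; (suc _) → 0ℤ }) , (λ { zero → 0ℤ ; (suc _) → 1ℤ }) ,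
        λ i → ⟦ lb i ⟧ zero , ⟦ lb i ⟧ (suc zero) ,
        λ { zero       → divides 0ℤ (identity₁ (⟦ lb i ⟧ zero) (⟦ lb i ⟧ (suc zero)))
          ; (suc zero) → divides 0ℤ (identity₂ (⟦ lb i ⟧ zero) (⟦ lb i ⟧ (suc zero))) }
        where
        open Fan F
        identity₁ : ∀ x y → x - (x * 1ℤ + y * 0ℤ) ≡ 0ℤ
        identity₁ = solve-∀
        identity₂ : ∀ x y → y - (x * 0ℤ + y * 1ℤ) ≡ 0ℤ
        identity₂ = solve-∀
      coplanar {ℕ.suc (ℕ.suc (ℕ.suc _))} _ F with u , v , u∈B , v∈B , angle , L⊆Π ← Fan.plane F =
        FanCount.plane⇒coplanar F u v u∈B v∈B angle L⊆Π

  -- Reduction from a function in the span to a single hyperplane.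

  ∑-*-mod : {A : Set} (xs : List A) {m : ℕ.ℕ} (f g h : A → ℕ.ℕ) →
            (∀ x → ModEq m (f x) (g x)) →
            m ℕ∣.∣ ∑ xs (λ x → g x ℕ.* h x) → m ℕ∣.∣ ∑ xs (λ x → f x ℕ.* h x)
  ∑-*-mod xs {m} f g h f≡g m∣g = ∣⇒∣ᵤ
    (∣-lin₂ (difference xs) (∣ᵤ⇒∣ {+ m} {+ ∑ xs (λ x → g x ℕ.* h x)} m∣g) 1ℤ 1ℤ
      (identity₀ (+ ∑ xs (λ x → f x ℕ.* h x)) (+ ∑ xs (λ x → g x ℕ.* h x))))
    where
    identity₀ : ∀ F G → F ≡ 1ℤ * (F - G) + 1ℤ * G
    identity₀ = solve-∀
    identity : ∀ f g h F G → f * h + F - (g * h + G) ≡ h * (f - g) + 1ℤ * (F - G)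
    identity = solve-∀
    difference : ∀ xs → + m ∣ + ∑ xs (λ x → f x ℕ.* h x) - + ∑ xs (λ x → g x ℕ.* h x)
    difference []       = divides 0ℤ refl
    difference (x ∷ xs) = subst₂ (λ z w → + m ∣ z + + ∑ xs (λ x → f x ℕ.* h x) - (w + + ∑ xs (λ x → g x ℕ.* h x)))
      (sym (ℤₚ.pos-* (f x) (h x))) (sym (ℤₚ.pos-* (g x) (h x)))
      (∣-lin₂ (ModEq⇒∣ (f x) (g x) (f≡g x)) (difference xs) (+ h x) 1ℤ
        (identity (+ f x) (+ g x) (+ h x)
          (+ ∑ xs (λ x → f x ℕ.* h x)) (+ ∑ xs (λ x → g x ℕ.* h x))))

open import Data.Nat using (ℕ; _≤_; _+_; _*_)
open import Data.Nat.Divisibility using (_∣_)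

∑-combo : ∀ p k {n} (xs : List (Pt p k n)) (h : Pt p k n → ℕ) →
  (∀ a b → p ∣ ∑ xs (λ x → ind (inHyp? p k a b x) * h x)) →
  ∀ ts → p ∣ ∑ xs (λ x → combo p k ts x * h x)
∑-combo p k xs h H []                 = subst (p ∣_) (sym (∑-zero xs λ _ → refl)) (p ℕ∣.∣0)
∑-combo p k xs h H ((c , a , b) ∷ ts) = subst (p ∣_) (sym (begin
    ∑ xs (λ x → (c * ind (inHyp? p k a b x) + combo p k ts x) * h x)
      ≡⟨ ∑-cong xs (λ x → trans (ℕₚ.*-distribʳ-+ (h x) (c * ind (inHyp? p k a b x)) (combo p k ts x))
           (cong (_+ combo p k ts x * h x) (ℕₚ.*-assoc c (ind (inHyp? p k a b x)) (h x)))) ⟩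
    ∑ xs (λ x → c * (ind (inHyp? p k a b x) * h x) + combo p k ts x * h x)
      ≡⟨ ∑-distrib-+ xs (λ x → c * (ind (inHyp? p k a b x) * h x)) (λ x → combo p k ts x * h x) ⟩
    ∑ xs (λ x → c * (ind (inHyp? p k a b x) * h x)) + ∑ xs (λ x → combo p k ts x * h x)
      ≡⟨ cong (_+ ∑ xs (λ x → combo p k ts x * h x)) (∑-*ˡ xs c (λ x → ind (inHyp? p k a b x) * h x)) ⟩
    c * ∑ xs (λ x → ind (inHyp? p k a b x) * h x) + ∑ xs (λ x → combo p k ts x * h x) ∎))
  (ℕ∣.∣m∣n⇒∣m+n (ℕ∣.∣n⇒∣m*n c (H a b)) (∑-combo p k xs h H ts))
  where open ≡-Reasoning

theorem8p3 : (p k n : ℕ) → Prime p → 2 ≤ n →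
    (f : Pt p k n → ℕ) → InH p k f →
    (X : Fan p k n) →
    p ∣ sum (map (λ x → f x * ind (inFan? p k X x)) (allPoints n (q p k)))
theorem8p3 p k n pr 2≤n f (ts , _ , f≡combo) X =
  ∑-*-mod points f (combo p k ts) (λ x → ind (inFan? p k X x)) f≡combo
    (∑-combo p k points (λ x → ind (inFan? p k X x))
      -- The product of the indicators of H and X is the indicator of H ∩ X.
      (λ a b → subst (p ∣_)
        (sym (∑-cong points λ x → ind-× (inHyp? p k a b x) (inFan? p k X x)))
        (hyperplane-count (coplanar k 2≤n X) a b))
      ts)
  where
  open PrimePowers p pr
  open FanCount k X using (hyperplane-count)
  points = allPoints n (q p k)
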